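{- For every matroid $M$ and every integer $i>0$, $$c_M(i) = \sum_{r=1}^i\;\sum_{S\subset [r]} (-1)^{|S|} \sum_{\substack{a_0<a_1<\cdots < a_r<a_{r+1}\\ a_0 = 0,\ a_r = i,\ a_{r+1} = \operatorname{rk} M-i}} W_M\Big(a_{t_{r}(S)} + a_{r-1},\ldots,a_{t_{1}(S)} + a_{0}\Big),$$ where the innermost sum is over sequences of integers $a_0,\dots,a_{r+1}$ satisfying the stated conditions.
   Context: Let $M$ be a matroid on a finite ground set $\mathcal{I}$ with lattice of flats $L$, and write $\hat 0$ for the minimal flat. For a flat $F$, the localization $M_F$ is the matroid on ground set $F$ whose lattice of flats is $\{G\in L : G\le F\}$, and the contraction $M^F$ is the matroid on $\mathcal{I}\smallsetminus F$ whose lattice of flats is isomorphic to $\{G\in L: G\ge F\}$. Set $\operatorname{rk} F := \operatorname{rk} M_F$ and $\operatorname{crk} F := \operatorname{rk} M - \operatorname{rk} F$. Let $\mu$ be the Möbius function of $L$ and $\chi_M(t)=\sum_{F}\mu(\hat 0,F)t^{\operatorname{crk} F}$ the characteristic polynomial. The Kazhdan–Lusztig polynomial $P_M(t)\in\mathbb{Z}[t]$ is the unique assignment of a polynomial to every matroid such that: $P_M(t)=1$ if $\operatorname{rk} M=0$; $\deg P_M(t)<\tfrac12\operatorname{rk} M$ if $\operatorname{rk} M>0$; and $t^{\operatorname{rk} M}P_M(t^{ -1})=\sum_{F\in L}\chi_{M_F}(t)P_{M^F}(t)$. Let $c_M(i)$ be the coefficient of $t^i$ in $P_M(t)$. For integers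 $i_r,\dots,i_1$, the $r$-Whitney number is $W_M(i_r,\ldots,i_1) := \#\{(F_r,\ldots,F_1)\in L^r : F_r\le F_{r-1}\le\cdots\le F_1,\ \operatorname{crk}F_j=i_j \text{ for all } j\}$. For a positive integer $r$ and $S\subset[r]=\{1,\dots,r\}$, and $1\le j\le r$, let $t_j(S):=\min\{k : k\ge j,\ k\notin S\}\in\{1,\dots,r+1\}$. -}

module Defs where

open import Data.Bool using (Bool; true; false; _∧_; _∨_; not; if_then_else_)
open import Data.Nat using (ℕ; zero; suc; _+_; _∸_; _≤_; _<_; _≤ᵇ_; _<ᵇ_; _≡ᵇ_)
open import Data.Fin using (Fin)
open import Data.Fin.Subset using (Subset; _∪_; _∩_; ⁅_⁆; _⊆_; ∣_∣; ⊤; ⊥)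
open import Data.Vec using (Vec; []; _∷_; lookup; toList)
open import Data.List using (List; []; _∷_; _++_; map; length; filterᵇ; allFin; downFrom; upTo; foldr)
open import Data.Integer as ℤ using (ℤ)
open import Relation.Binary.PropositionalEquality using (_≡_)

record Matroid (n : ℕ) : Set where
  field
    rk        : Subset n → ℕ
    rk-bound  : ∀ X → rk X ≤ ∣ X ∣
    rk-mono   : ∀ {X Y} → X ⊆ Y → rk X ≤ rk Y
    rk-submod : ∀ X Y → rk (X ∪ Y) + rk (X ∩ Y) ≤ rk X + rk Y

open Matroid public

all : ∀ {A : Set} → (A → Bool) → List A → Bool
all p = foldr (λ x b → p x ∧ b) true

allSubsets : (n : ℕ) → List (Subset n)
allSubsets zero    = [] ∷ []
allSubsets (suc n) = map (true ∷_) (allSubsets n) ++ map (false ∷_) (allSubsets n)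

_⊆ᵇ_ : ∀ {n} → Subset n → Subset n → Bool
_⊆ᵇ_ {n} X Y = all (λ e → not (lookup X e) ∨ lookup Y e) (allFin n)

_≟ˢ_ : ∀ {n} → Subset n → Subset n → Bool
X ≟ˢ Y = (X ⊆ᵇ Y) ∧ (Y ⊆ᵇ X)

sumℤ : List ℤ → ℤ
sumℤ = foldr ℤ._+_ (ℤ.+ 0)

module _ {n : ℕ} (M : Matroid n) where

  isFlat : Subset n → Bool
  isFlat F = all (λ e → lookup F e ∨ (rk M F <ᵇ rk M (F ∪ ⁅ e ⁆))) (allFin n)

  flats : List (Subset n)
  flats = filterᵇ isFlat (allSubsets n)

  closure : Subset n → Subset n
  closure X = Data.Vec.map (λ e → rk M (X ∪ ⁅ e ⁆) ≡ᵇ rk M X) (Data.Vec.allFin n)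
    where import Data.Vec

  bottom : Subset n
  bottom = closure ⊥

  rkM : ℕ
  rkM = rk M ⊤

  crk : Subset n → ℕ
  crk F = rkM ∸ rk M F

  interval : Subset n → Subset n → List (Subset n)
  interval F G = filterᵇ (λ K → (F ⊆ᵇ K) ∧ (K ⊆ᵇ G)) flats

  -- Möbius function of L: μ(F,F) = 1, μ(F,G) = - Σ_{F ≤ K < G} μ(F,K)
  -- for F < G, and 0 if F ≰ G.  (Fuel: strict chains of subsets of Fin n
  -- have length ≤ n + 1, so suc (suc n) steps always suffice.)
  mobius′ : ℕ → Subset n → Subset n → ℤ
  mobius′ zero    F G = ℤ.+ 0
  mobius′ (suc f) F G =
    if F ≟ˢ G then ℤ.+ 1
    else if F ⊆ᵇ G
      then ℤ.- sumℤ (map (mobius′ f F)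
                          (filterᵇ (λ K → not (K ≟ˢ G)) (interval F G)))
      else ℤ.+ 0

  mobius : Subset n → Subset n → ℤ
  mobius = mobius′ (suc (suc n))

  -- Polynomials are coefficient functions ℕ → ℤ (coefficient of t^k).

  charPoly : Subset n → Subset n → ℕ → ℤ
  charPoly F H m =
    sumℤ (map (mobius F) (filterᵇ (λ K → (rk M H ∸ rk M K) ≡ᵇ m) (interval F H)))

polyMul : (ℕ → ℤ) → (ℕ → ℤ) → ℕ → ℤ
polyMul a b k = sumℤ (map (λ m → a m ℤ.* b (k ∸ m)) (upTo (suc k)))

polyRev : ℕ → (ℕ → ℤ) → ℕ → ℤ
polyRev d p k = if k ≤ᵇ d then p (d ∸ k) else ℤ.+ 0

polyOne : ℕ → ℤ
polyOne zero    = ℤ.+ 1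
polyOne (suc _) = ℤ.+ 0

-- Kazhdan–Lusztig polynomials.  The minors (M^F)_G of M (F ≤ G flats)
-- have lattice of flats the interval [F,G] of L, rank rk G - rk F,
-- localizations ↔ [F,H] and contractions ↔ [H,G].  A KL assignment for
-- M is a family P F G of coefficient functions on pairs of flats
-- satisfying the defining conditions for all these minors; P ⊥̂ ⊤ is P_M.

module _ {n : ℕ} (M : Matroid n) where

  IsKL : (Subset n → Subset n → ℕ → ℤ) → Set
  IsKL P =
    ∀ F G → isFlat M F ≡ true → isFlat M G ≡ true → (F ⊆ᵇ G) ≡ true →
      ((rk M G ∸ rk M F ≡ 0 → ∀ k → P F G k ≡ polyOne k))
    ×
      ((0 < rk M G ∸ rk M F) → ∀ k → rk M G ∸ rk M F ≤ k + k → P F G k ≡ ℤ.+ 0)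
    ×
      (∀ k → polyRev (rk M G ∸ rk M F) (P F G) k
             ≡ sumℤ (map (λ H → polyMul (charPoly M F H) (P H G) k) (interval M F G)))
    where open import Data.Product using (_×_)

-- r-Whitney numbers.  W_M(i_r,…,i_1) for the list (i_r ∷ … ∷ i_1):
-- number of tuples (F_r,…,F_1) of flats with F_r ≤ … ≤ F_1, crk F_j = i_j.

module _ {n : ℕ} (M : Matroid n) where

  tuples : ℕ → List (List (Subset n))
  tuples zero    = [] ∷ []
  tuples (suc r) = Data.List.concatMap (λ F → map (F ∷_) (tuples r)) (flats M)
    where import Data.List

  isChain : List (Subset n) → Bool
  isChain []           = true
  isChain (F ∷ [])     = true
  isChain (F ∷ G ∷ Fs) = (F ⊆ᵇ G) ∧ isChain (G ∷ Fs)

  crksMatch : List (Subset n) → List ℕ → Bool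
  crksMatch []       []       = true
  crksMatch (F ∷ Fs) (i ∷ is) = (crk M F ≡ᵇ i) ∧ crksMatch Fs is
  crksMatch _        _        = false

  whitney : List ℕ → ℕ
  whitney is = length (filterᵇ (λ Fs → isChain Fs ∧ crksMatch Fs is) (tuples (length is)))

-- membership of k ∈ {1,…,r} in S ⊆ [r]; S is a Subset r where
-- position p (0-based) stands for the element p + 1.
memb : List Bool → ℕ → Bool
memb []       _             = false
memb (b ∷ bs) zero          = false
memb (b ∷ bs) (suc zero)    = b
memb (b ∷ bs) (suc (suc k)) = memb bs (suc k)

tIdx : (r : ℕ) → Subset r → ℕ → ℕ
tIdx r S j = go (suc r ∸ j) j
  where
  go : ℕ → ℕ → ℕ
  go zero    k = k
  go (suc f) k = if memb (toList S) k then go f (suc k) else k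

vecs : ℕ → ℕ → List (List ℕ)
vecs zero      b = [] ∷ []
vecs (suc len) b = Data.List.concatMap (λ x → map (x ∷_) (vecs len b)) (upTo (suc b))
  where import Data.List

nth : List ℕ → ℕ → ℕ
nth []       _       = 0
nth (x ∷ xs) zero    = x
nth (x ∷ xs) (suc k) = nth xs k

strictlyIncr : List ℕ → Bool
strictlyIncr []           = true
strictlyIncr (x ∷ [])     = true
strictlyIncr (x ∷ y ∷ xs) = (x <ᵇ y) ∧ strictlyIncr (y ∷ xs)

-- integer sequences a_0 < a_1 < … < a_r < a_{r+1} with a_0 = 0, a_r = i,
-- a_{r+1} = rk M - i (as integers); all entries lie in {0,…,R}, R = rk M.
sequences : (R r i : ℕ) → List (List ℕ)
sequences R r i =
  filterᵇ (λ a → strictlyIncr a ∧ (nth a 0 ≡ᵇ 0) ∧ (nth a r ≡ᵇ i)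
                 ∧ ((nth a (suc r) + i) ≡ᵇ R))
          (vecs (suc (suc r)) R)

whitneyArgs : (r : ℕ) → Subset r → List ℕ → List ℕ
whitneyArgs r S a = map (λ j → nth a (tIdx r S j) + nth a (j ∸ 1)) (map suc (downFrom r))

rhs : ∀ {n} → Matroid n → ℕ → ℤ
rhs M i =
  sumℤ (map (λ r →
    sumℤ (map (λ S →
      sumℤ (map (λ a → ((ℤ.- (ℤ.+ 1)) ℤ.^ ∣ S ∣) ℤ.* ℤ.+ (whitney M (whitneyArgs r S a)))
                (sequences (rkM M) r i)))
      (allSubsets r)))
    (map suc (upTo i)))

{-# OPTIONS --safe #-}
module Submission where

-- Möbius inversion turns the defining identity of the Kazhdan–Lusztig polynomials into the palindromicity
-- of Z_M(t) = ∑_F t^(rk F) P_{M^F}(t).  Comparing the coefficients of t^i and t^(rk M - i), for i < rk M - i,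
--   c_M(i) = [i = 0] + ∑_{x < i} (∑_{crk G = i + x} c_{M^G}(x) - ∑_{crk G = rk M - i + x} c_{M^G}(x)),
-- because the degree bound kills c_{M^G}(crk G - i) unless crk G - i < i or crk G = i = 0.  Unrolling this
-- recursion r times, with a_r = i > a_{r-1} = x > …, and recording in S the steps at which the second sum is
-- chosen, gives the formula: the first choice continues with (a_{r+1}, a_r) := (i, x), the second keeps a_{r+1}.

open import Defs
open import Data.Nat using (ℕ; _<_)
open import Data.Fin.Subset using (Subset; ⊤)
open import Data.Integer using (ℤ)
open import Relation.Binary.PropositionalEquality using (_≡_)

open import Data.Bool using (Bool; true; false; _∧_; _∨_; not; if_then_else_; T)
open import Data.Bool.Properties using (T-≡; ¬-not; ∧-assoc; ∧-comm; ∧-identityʳ)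
open import Data.Empty using (⊥-elim)
open import Data.Fin using (Fin)
open import Data.Fin.Subset using (⊥; ⁅_⁆; _∪_; _⊆_; _∈_; ∣_∣)
open import Data.Fin.Subset.Properties using (⊆-refl; ⊆-trans; ⊆-antisym; ∈⊤; p⊆p∪q; q⊆p∪q; x∈⁅x⁆; x∈⁅y⁆⇒x≡y; x∈p∪q⁻; ∣p∣≤n; ∣⊥∣≡0; ∪-identityˡ; _∈?_)
import Data.Integer as ℤ
open import Data.Integer using (0ℤ; 1ℤ; -1ℤ; _^_) renaming (_+_ to _+ᶻ_; _*_ to _*ᶻ_; _-_ to _-ᶻ_; -_ to -ᶻ_)
import Data.Integer.Properties as ℤP
open import Data.Integer.Tactic.RingSolver using (solve-∀)
open import Data.List using (List; []; _∷_; _++_; map; length; filterᵇ; allFin; upTo; downFrom; concatMap; [_])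
open import Data.List.Properties using (map-upTo; ++-assoc)
open import Data.List.Membership.Propositional using () renaming (_∈_ to _∈ₗ_)
open import Data.List.Membership.Propositional.Properties using (∈-allFin)
open import Data.List.Relation.Unary.Any using (here; there)
open import Data.Nat using (zero; suc; _+_; _∸_; _≤_; z≤n; s≤s; _≤ᵇ_; _<ᵇ_; _≡ᵇ_; _≤?_)
open import Data.Nat.Properties using (≡ᵇ⇒≡; ≡⇒≡ᵇ; <ᵇ⇒<; <⇒<ᵇ; ≤ᵇ⇒≤; ≤⇒≤ᵇ)
import Data.Nat.Properties as ℕP
open import Data.Product using (_×_; _,_; proj₁; proj₂)
open import Data.Sum using (_⊎_; inj₁; inj₂)
open import Data.Vec using ([]; _∷_; lookup; toList; _∷ʳ_)
import Data.Vec
open import Data.Vec.Properties using ([]=⇒lookup; lookup⇒[]=; lookup-map; lookup-allFin; ∷-injectiveˡ; ∷-injectiveʳ)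
open import Function using (_∘_; Equivalence)
open import Relation.Binary.PropositionalEquality using (refl; sym; trans; cong; cong₂; subst; module ≡-Reasoning)
open import Relation.Nullary using (¬_; Dec; yes; no)

-- The recursion for `M` involves the contractions at flats above, so it is stated for every flat
-- `F`, with `t` the degree paired with `i`: `crk M F ≡ i + t` and `i < t`. Although `t` is
-- determined by `F` and `i`, it is carried as a separate argument. This lets `E` and the signed
-- chain sums be defined for arbitrary arguments and compared without side conditions; the two
-- constraints enter only where coefficients do. Both continuations preserve them: corank `i + x`
-- leads to the pair `x < i`, corank `t + x` to the pair `x < t`. The recursive definition of
-- `mobius` gives only μζ = δ at once. Instead of deriving ζμ = δ, the Z-polynomials and their
-- reversals are compared after applying μ: both become the reversed Kazhdan-Lusztig polynomials,
-- and μ is injective. On the combinatorial side the obstacle is direction. The recursion strips the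
-- largest index first, whereas `allSubsets` and `vecs` grow at the front, and the membership of the
-- last element of S can affect every t_j whose search runs through to the end of S.

infix 4 _⟺_

-- Booleans and indicator factors

_⟺_ : Bool → Bool → Set
a ⟺ b = (a ≡ true → b ≡ true) × (b ≡ true → a ≡ true)

⟺⇒≡ : ∀ {a b} → a ⟺ b → a ≡ b
⟺⇒≡ {true}  {true}  _       = refl
⟺⇒≡ {true}  {false} (f , _) = sym (f refl)
⟺⇒≡ {false} {true}  (_ , g) = g refl
⟺⇒≡ {false} {false} _       = refl

false≢true : ∀ {b} → b ≡ false → ¬ b ≡ true
false≢true refl ()

true-or-false : ∀ b → b ≡ true ⊎ b ≡ false
true-or-false true  = inj₁ refl
true-or-false false = inj₂ refl

T⇒true : ∀ {b} → T b → b ≡ true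
T⇒true = Equivalence.to T-≡

true⇒T : ∀ {b} → b ≡ true → T b
true⇒T = Equivalence.from T-≡

∧-true⁻ : ∀ {a b} → a ∧ b ≡ true → a ≡ true × b ≡ true
∧-true⁻ {true} {true} _ = refl , refl

∧-true⁺ : ∀ {a b} → a ≡ true → b ≡ true → a ∧ b ≡ true
∧-true⁺ refl refl = refl

≡ᵇ-true⁻ : ∀ {m n} → (m ≡ᵇ n) ≡ true → m ≡ n
≡ᵇ-true⁻ {m} {n} = ≡ᵇ⇒≡ m n ∘ true⇒T

≡ᵇ-true⁺ : ∀ {m n} → m ≡ n → (m ≡ᵇ n) ≡ true
≡ᵇ-true⁺ {m} {n} = T⇒true ∘ ≡⇒≡ᵇ m n

<ᵇ-true⁻ : ∀ {m n} → (m <ᵇ n) ≡ true → m < n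
<ᵇ-true⁻ {m} {n} = <ᵇ⇒< m n ∘ true⇒T

<ᵇ-true⁺ : ∀ {m n} → m < n → (m <ᵇ n) ≡ true
<ᵇ-true⁺ = T⇒true ∘ <⇒<ᵇ

≤ᵇ-true⁻ : ∀ {m n} → (m ≤ᵇ n) ≡ true → m ≤ n
≤ᵇ-true⁻ {m} {n} = ≤ᵇ⇒≤ m n ∘ true⇒T

≤ᵇ-true⁺ : ∀ {m n} → m ≤ n → (m ≤ᵇ n) ≡ true
≤ᵇ-true⁺ = T⇒true ∘ ≤⇒≤ᵇ

ι : Bool → ℤ
ι b = if b then 1ℤ else 0ℤ

ι-∧ : ∀ a b → ι (a ∧ b) ≡ ι a *ᶻ ι b
ι-∧ true  b = sym (ℤP.*-identityˡ (ι b))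
ι-∧ false b = sym (ℤP.*-zeroˡ (ι b))

-- Conditions are kept as 0/1 factors over fixed lists, so that sums can be exchanged freely; this
-- recovers the condition as a hypothesis whenever the summand has to be rewritten.
ι-cong : ∀ {b x y} → (b ≡ true → x ≡ y) → ι b *ᶻ x ≡ ι b *ᶻ y
ι-cong {true}          h = cong (1ℤ *ᶻ_) (h refl)
ι-cong {false} {x} {y} _ = trans (ℤP.*-zeroˡ x) (sym (ℤP.*-zeroˡ y))

ι-true : ∀ {b} x → b ≡ true → ι b *ᶻ x ≡ x
ι-true x refl = ℤP.*-identityˡ x

ι-false : ∀ {b} x → ¬ b ≡ true → ι b *ᶻ x ≡ 0ℤ
ι-false x h rewrite ¬-not h = ℤP.*-zeroˡ x

-- Finite sums

∑ : {A : Set} → List A → (A → ℤ) → ℤ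
∑ l f = sumℤ (map f l)

infix 5 ∑
syntax ∑ l (λ x → e) = ∑[ x ∈ l ] e

module _ {A : Set} where

  ∑-cong : ∀ (l : List A) {f g : A → ℤ} → (∀ x → f x ≡ g x) → ∑ l f ≡ ∑ l g
  ∑-cong []      h = refl
  ∑-cong (x ∷ l) h = cong₂ _+ᶻ_ (h x) (∑-cong l h)

  ∑-cong-filterᵇ : ∀ (p : A → Bool) (l : List A) {f g : A → ℤ} →
    (∀ x → p x ≡ true → f x ≡ g x) → ∑ (filterᵇ p l) f ≡ ∑ (filterᵇ p l) g
  ∑-cong-filterᵇ p []      h = refl
  ∑-cong-filterᵇ p (x ∷ l) h with p x in eq
  ... | true  = cong₂ _+ᶻ_ (h x eq) (∑-cong-filterᵇ p l h)
  ... | false = ∑-cong-filterᵇ p l h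

  ∑-zero : ∀ (l : List A) {f : A → ℤ} → (∀ x → f x ≡ 0ℤ) → ∑ l f ≡ 0ℤ
  ∑-zero []      h = refl
  ∑-zero (x ∷ l) h = cong₂ _+ᶻ_ (h x) (∑-zero l h)

  ∑-+ : ∀ (l : List A) (f g : A → ℤ) → (∑[ x ∈ l ] (f x +ᶻ g x)) ≡ ∑ l f +ᶻ ∑ l g
  ∑-+ []      f g = refl
  ∑-+ (x ∷ l) f g = trans (cong (f x +ᶻ g x +ᶻ_) (∑-+ l f g)) (interchange (f x) (g x) (∑ l f) (∑ l g))
    where
    interchange : ∀ a b c d → a +ᶻ b +ᶻ (c +ᶻ d) ≡ a +ᶻ c +ᶻ (b +ᶻ d)
    interchange = solve-∀

  ∑-*ˡ : ∀ (l : List A) c (f : A → ℤ) → (∑[ x ∈ l ] (c *ᶻ f x)) ≡ c *ᶻ ∑ l f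
  ∑-*ˡ []      c f = sym (ℤP.*-zeroʳ c)
  ∑-*ˡ (x ∷ l) c f = trans (cong (c *ᶻ f x +ᶻ_) (∑-*ˡ l c f)) (sym (ℤP.*-distribˡ-+ c (f x) (∑ l f)))

  ∑-*ʳ : ∀ (l : List A) c (f : A → ℤ) → (∑[ x ∈ l ] (f x *ᶻ c)) ≡ ∑ l f *ᶻ c
  ∑-*ʳ l c f = trans (∑-cong l (λ x → ℤP.*-comm (f x) c)) (trans (∑-*ˡ l c f) (ℤP.*-comm c (∑ l f)))

  ∑-- : ∀ (l : List A) (f g : A → ℤ) → (∑[ x ∈ l ] (f x -ᶻ g x)) ≡ ∑ l f -ᶻ ∑ l g
  ∑-- []      f g = refl
  ∑-- (x ∷ l) f g = trans (cong (f x -ᶻ g x +ᶻ_) (∑-- l f g)) (interchange (f x) (g x) (∑ l f) (∑ l g))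
    where
    interchange : ∀ a b c d → a -ᶻ b +ᶻ (c -ᶻ d) ≡ a +ᶻ c -ᶻ (b +ᶻ d)
    interchange = solve-∀

  ∑-++ : ∀ (l l′ : List A) (f : A → ℤ) → ∑ (l ++ l′) f ≡ ∑ l f +ᶻ ∑ l′ f
  ∑-++ []      l′ f = sym (ℤP.+-identityˡ _)
  ∑-++ (x ∷ l) l′ f = trans (cong (f x +ᶻ_) (∑-++ l l′ f)) (sym (ℤP.+-assoc (f x) (∑ l f) (∑ l′ f)))

  ∑-map : ∀ {B : Set} (g : B → A) (l : List B) (f : A → ℤ) → ∑ (map g l) f ≡ ∑ l (f ∘ g)
  ∑-map g []      f = refl
  ∑-map g (x ∷ l) f = cong (f (g x) +ᶻ_) (∑-map g l f)

  ∑-concatMap : ∀ {B : Set} (g : B → List A) (l : List B) (f : A → ℤ) →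
    ∑ (concatMap g l) f ≡ (∑[ x ∈ l ] ∑ (g x) f)
  ∑-concatMap g []      f = refl
  ∑-concatMap g (x ∷ l) f = trans (∑-++ (g x) (concatMap g l) f) (cong (∑ (g x) f +ᶻ_) (∑-concatMap g l f))

  ∑-filterᵇ : ∀ (p : A → Bool) (l : List A) (f : A → ℤ) →
    ∑ (filterᵇ p l) f ≡ (∑[ x ∈ l ] ι (p x) *ᶻ f x)
  ∑-filterᵇ p []      f = refl
  ∑-filterᵇ p (x ∷ l) f with p x
  ... | true  = cong₂ _+ᶻ_ (sym (ℤP.*-identityˡ (f x))) (∑-filterᵇ p l f)
  ... | false = trans (∑-filterᵇ p l f)
                  (trans (sym (ℤP.+-identityˡ _)) (cong (_+ᶻ (∑[ y ∈ l ] ι (p y) *ᶻ f y)) (sym (ℤP.*-zeroˡ (f x)))))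

  length-filterᵇ : ∀ (p : A → Bool) (l : List A) → ℤ.+ length (filterᵇ p l) ≡ (∑[ x ∈ l ] ι (p x))
  length-filterᵇ p []      = refl
  length-filterᵇ p (x ∷ l) with p x
  ... | true  = cong (1ℤ +ᶻ_) (length-filterᵇ p l)
  ... | false = trans (length-filterᵇ p l) (sym (ℤP.+-identityˡ _))

∑-swap : ∀ {A B : Set} (l : List A) (l′ : List B) (f : A → B → ℤ) →
  (∑[ x ∈ l ] ∑[ y ∈ l′ ] f x y) ≡ (∑[ y ∈ l′ ] ∑[ x ∈ l ] f x y)
∑-swap []      l′ f = sym (∑-zero l′ (λ _ → refl))
∑-swap (x ∷ l) l′ f = trans (cong (∑ l′ (f x) +ᶻ_) (∑-swap l l′ f)) (sym (∑-+ l′ (f x) (λ y → ∑[ x ∈ l ] f x y)))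

∑-upTo-suc : ∀ n (f : ℕ → ℤ) → ∑ (upTo (suc n)) f ≡ f 0 +ᶻ ∑ (upTo n) (f ∘ suc)
∑-upTo-suc n f = cong (f 0 +ᶻ_) (trans (cong (λ l → ∑ l f) (sym (map-upTo suc n))) (∑-map suc (upTo n) f))

∑-upTo-δ : ∀ n d (f : ℕ → ℤ) → (∑[ m ∈ upTo n ] ι (d ≡ᵇ m) *ᶻ f m) ≡ ι (d <ᵇ n) *ᶻ f d
∑-upTo-δ zero    d       f = sym (ℤP.*-zeroˡ (f d))
∑-upTo-δ (suc n) zero    f = trans (∑-upTo-suc n (λ m → ι (0 ≡ᵇ m) *ᶻ f m))
  (trans (cong (1ℤ *ᶻ f 0 +ᶻ_) (∑-zero (upTo n) (λ m → ℤP.*-zeroˡ (f (suc m))))) (ℤP.+-identityʳ _))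
∑-upTo-δ (suc n) (suc d) f = trans (∑-upTo-suc n (λ m → ι (suc d ≡ᵇ m) *ᶻ f m))
  (trans (cong₂ _+ᶻ_ (ℤP.*-zeroˡ (f 0)) (∑-upTo-δ n d (f ∘ suc))) (ℤP.+-identityˡ _))

-- Subsets and flats

all-true⁻ : ∀ {A : Set} (p : A → Bool) l → all p l ≡ true → ∀ {x} → x ∈ₗ l → p x ≡ true
all-true⁻ p (x ∷ l) h (here refl) = proj₁ (∧-true⁻ h)
all-true⁻ p (x ∷ l) h (there m)   = all-true⁻ p l (proj₂ (∧-true⁻ {p x} h)) m

all-true⁺ : ∀ {A : Set} (p : A → Bool) l → (∀ x → p x ≡ true) → all p l ≡ true
all-true⁺ p []      h = refl
all-true⁺ p (x ∷ l) h = ∧-true⁺ (h x) (all-true⁺ p l h)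

module _ {n : ℕ} where

  ⊆ᵇ-true⁻ : ∀ {X Y : Subset n} → (X ⊆ᵇ Y) ≡ true → X ⊆ Y
  ⊆ᵇ-true⁻ {X} {Y} h {e} e∈X = lookup⇒[]= e Y (trans (sym (drop-not ([]=⇒lookup e∈X))) (all-true⁻ _ (allFin n) h (∈-allFin e)))
    where
    drop-not : ∀ {a b} → a ≡ true → (not a ∨ b) ≡ b
    drop-not refl = refl

  ⊆ᵇ-true⁺ : ∀ {X Y : Subset n} → X ⊆ Y → (X ⊆ᵇ Y) ≡ true
  ⊆ᵇ-true⁺ {X} {Y} h = all-true⁺ _ (allFin n) pointwise
    where
    pointwise : ∀ e → (not (lookup X e) ∨ lookup Y e) ≡ true
    pointwise e with lookup X e in eq
    ... | true  = []=⇒lookup (h (lookup⇒[]= e X eq))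
    ... | false = refl

  ≟ˢ-true⁻ : ∀ {X Y : Subset n} → (X ≟ˢ Y) ≡ true → X ≡ Y
  ≟ˢ-true⁻ {X} {Y} h = ⊆-antisym (⊆ᵇ-true⁻ (proj₁ (∧-true⁻ h))) (⊆ᵇ-true⁻ {Y} {X} (proj₂ (∧-true⁻ {X ⊆ᵇ Y} h)))

  ≟ˢ-refl : ∀ (X : Subset n) → (X ≟ˢ X) ≡ true
  ≟ˢ-refl X = ∧-true⁺ (⊆ᵇ-true⁺ {X} {X} ⊆-refl) (⊆ᵇ-true⁺ {X} {X} ⊆-refl)

  ⊆ᵇ-trans : ∀ {X Y Z : Subset n} → (X ⊆ᵇ Y) ≡ true → (Y ⊆ᵇ Z) ≡ true → (X ⊆ᵇ Z) ≡ true
  ⊆ᵇ-trans {X} {Y} {Z} a b = ⊆ᵇ-true⁺ {X} {Z} (⊆-trans (⊆ᵇ-true⁻ {X} {Y} a) (⊆ᵇ-true⁻ {Y} {Z} b))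

  ⊆ᵇ-refl : ∀ (X : Subset n) → (X ⊆ᵇ X) ≡ true
  ⊆ᵇ-refl X = ⊆ᵇ-true⁺ {X} {X} ⊆-refl

  ⊆ᵇ-⊤ : ∀ (X : Subset n) → (X ⊆ᵇ ⊤) ≡ true
  ⊆ᵇ-⊤ X = ⊆ᵇ-true⁺ {X} {⊤} (λ _ → ∈⊤)

∷-≟ˢ : ∀ {n} b (X Y : Subset n) → ((b ∷ X) ≟ˢ (b ∷ Y)) ≡ (X ≟ˢ Y)
∷-≟ˢ b X Y = ⟺⇒≡
  ( (λ h → subst (λ Z → (X ≟ˢ Z) ≡ true) (∷-injectiveʳ (≟ˢ-true⁻ {X = b ∷ X} {b ∷ Y} h)) (≟ˢ-refl X))
  , (λ h → subst (λ Z → ((b ∷ X) ≟ˢ (b ∷ Z)) ≡ true) (≟ˢ-true⁻ {X = X} {Y} h) (≟ˢ-refl (b ∷ X))) )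

-- The enumeration lists each subset exactly once: the head of `Y` selects one half of the list and
-- the other half contributes nothing.
∑-allSubsets-δ : ∀ {n} (Y : Subset n) (f : Subset n → ℤ) → (∑[ X ∈ allSubsets n ] ι (X ≟ˢ Y) *ᶻ f X) ≡ f Y
∑-allSubsets-δ []      f = trans (ℤP.+-identityʳ _) (ℤP.*-identityˡ (f []))
∑-allSubsets-δ {suc n} (b ∷ Y) f = trans (∑-++ (map (true ∷_) (allSubsets n)) (map (false ∷_) (allSubsets n)) g)
    (trans (cong₂ _+ᶻ_ (∑-map (true ∷_) (allSubsets n) g) (∑-map (false ∷_) (allSubsets n) g)) (split b refl))
  where
  g : Subset (suc n) → ℤ
  g X = ι (X ≟ˢ (b ∷ Y)) *ᶻ f X
  same : ∀ a → a ≡ b → (∑[ X ∈ allSubsets n ] g (a ∷ X)) ≡ f (b ∷ Y)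
  same a refl = trans (∑-cong (allSubsets n) (λ X → cong (λ c → ι c *ᶻ f (a ∷ X)) (∷-≟ˢ a X Y)))
                  (∑-allSubsets-δ Y (f ∘ (a ∷_)))
  different : ∀ a → ¬ a ≡ b → (∑[ X ∈ allSubsets n ] g (a ∷ X)) ≡ 0ℤ
  different a a≢b = ∑-zero (allSubsets n) (λ X → ι-false (f (a ∷ X)) (λ h → a≢b (∷-injectiveˡ (≟ˢ-true⁻ {X = a ∷ X} {b ∷ Y} h))))
  split : ∀ c → c ≡ b → (∑[ X ∈ allSubsets n ] g (true ∷ X)) +ᶻ (∑[ X ∈ allSubsets n ] g (false ∷ X)) ≡ f (b ∷ Y)
  split true  refl = trans (cong₂ _+ᶻ_ (same true refl) (different false (λ ()))) (ℤP.+-identityʳ _)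
  split false refl = trans (cong₂ _+ᶻ_ (different true (λ ())) (same false refl)) (ℤP.+-identityˡ _)

module _ {n : ℕ} (M : Matroid n) where

  Flat : Subset n → Set
  Flat F = isFlat M F ≡ true

  flat-insert : ∀ {F e} → Flat F → ¬ e ∈ F → rk M F < rk M (F ∪ ⁅ e ⁆)
  flat-insert {F} {e} fF e∉F with lookup F e in eq | all-true⁻ _ (allFin n) fF (∈-allFin e)
  ... | true  | _ = ⊥-elim (e∉F (lookup⇒[]= e F eq))
  ... | false | h = <ᵇ-true⁻ h

  flat-intro : ∀ {F} → (∀ e → ¬ e ∈ F → rk M F < rk M (F ∪ ⁅ e ⁆)) → Flat F
  flat-intro {F} h = all-true⁺ _ (allFin n) pointwise
    where
    pointwise : ∀ e → (lookup F e ∨ (rk M F <ᵇ rk M (F ∪ ⁅ e ⁆))) ≡ true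
    pointwise e with lookup F e in eq
    ... | true  = refl
    ... | false = <ᵇ-true⁺ (h e (λ e∈F → false≢true eq ([]=⇒lookup e∈F)))

  ⊤-flat : Flat ⊤
  ⊤-flat = flat-intro {⊤} (λ e e∉⊤ → ⊥-elim (e∉⊤ ∈⊤))

  ∪⁅⁆-⊆ : ∀ {X Y : Subset n} {e} → X ⊆ Y → e ∈ Y → (X ∪ ⁅ e ⁆) ⊆ Y
  ∪⁅⁆-⊆ {X} {Y} {e} X⊆Y e∈Y m with x∈p∪q⁻ X ⁅ e ⁆ m
  ... | inj₁ x∈X = X⊆Y x∈X
  ... | inj₂ x∈e rewrite x∈⁅y⁆⇒x≡y e x∈e = e∈Y

  -- Otherwise some element of `G` outside `F` could be added to `F`, and by flatness this would
  -- already raise the rank above that of `G`.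
  rk-strict : ∀ {F G} → Flat F → (F ⊆ᵇ G) ≡ true → rk M G ≤ rk M F → F ≡ G
  rk-strict {F} {G} fF F⊆G r = ⊆-antisym (⊆ᵇ-true⁻ {X = F} {G} F⊆G) G⊆F
    where
    G⊆F : G ⊆ F
    G⊆F {e} e∈G with e ∈? F
    ... | yes e∈F = e∈F
    ... | no  e∉F = ⊥-elim (ℕP.<⇒≱ (ℕP.<-≤-trans (flat-insert fF e∉F)
                      (rk-mono M (∪⁅⁆-⊆ (⊆ᵇ-true⁻ {X = F} {G} F⊆G) e∈G))) r)

  rk-≤-rkM : ∀ X → rk M X ≤ rkM M
  rk-≤-rkM X = rk-mono M (λ _ → ∈⊤)

  rk-⊥ : rk M ⊥ ≡ 0
  rk-⊥ = ℕP.n≤0⇒n≡0 (subst (rk M ⊥ ≤_) (∣⊥∣≡0 n) (rk-bound M ⊥))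

  rk-∪-≤ : ∀ X Y → rk M (X ∪ Y) ≤ rk M X + rk M Y
  rk-∪-≤ X Y = ℕP.≤-trans (ℕP.m≤m+n _ _) (rk-submod M X Y)

  lookup-bottom : ∀ e → lookup (bottom M) e ≡ (rk M (⊥ ∪ ⁅ e ⁆) ≡ᵇ rk M ⊥)
  lookup-bottom e = trans (lookup-map e _ (Data.Vec.allFin n)) (cong (λ e → rk M (⊥ ∪ ⁅ e ⁆) ≡ᵇ rk M ⊥) (lookup-allFin e))

  loop⇒∈bottom : ∀ {e} → rk M ⁅ e ⁆ ≡ 0 → e ∈ bottom M
  loop⇒∈bottom {e} h = lookup⇒[]= e _ (trans (lookup-bottom e)
    (≡ᵇ-true⁺ (trans (cong (rk M) (∪-identityˡ ⁅ e ⁆)) (trans h (sym rk-⊥)))))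

  ∈bottom⇒loop : ∀ {e} → e ∈ bottom M → rk M ⁅ e ⁆ ≡ 0
  ∈bottom⇒loop {e} h = trans (sym (cong (rk M) (∪-identityˡ ⁅ e ⁆)))
    (trans (≡ᵇ-true⁻ (trans (sym (lookup-bottom e)) ([]=⇒lookup h))) rk-⊥)

  -- `bottom M` consists of loops, and by subadditivity of the rank, joining loops one at a time
  -- never leaves rank zero.
  rk-bottom : rk M (bottom M) ≡ 0
  rk-bottom = ℕP.n≤0⇒n≡0 (ℕP.≤-trans (rk-mono M (λ {e} m → loops-⊇ (allFin n) (∈-allFin e) m)) (ℕP.≤-reflexive (rk-loops (allFin n))))
    where
    loops : List (Fin n) → Subset n
    loops []      = ⊥
    loops (e ∷ l) = if lookup (bottom M) e then ⁅ e ⁆ ∪ loops l else loops l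

    rk-loops : ∀ l → rk M (loops l) ≡ 0
    rk-loops []      = rk-⊥
    rk-loops (e ∷ l) with lookup (bottom M) e in eq
    ... | false = rk-loops l
    ... | true  = ℕP.n≤0⇒n≡0 (ℕP.≤-trans (rk-∪-≤ ⁅ e ⁆ (loops l))
                    (ℕP.≤-reflexive (cong₂ _+_ (∈bottom⇒loop (lookup⇒[]= e (bottom M) eq)) (rk-loops l))))

    loops-⊇ : ∀ l {e} → e ∈ₗ l → e ∈ bottom M → e ∈ loops l
    loops-⊇ (e ∷ l) (here refl) m rewrite []=⇒lookup m = p⊆p∪q (loops l) (x∈⁅x⁆ e)
    loops-⊇ (e ∷ l) (there k)   m with lookup (bottom M) e
    ... | true  = q⊆p∪q ⁅ e ⁆ (loops l) (loops-⊇ l k m)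
    ... | false = loops-⊇ l k m

  bottom-flat : Flat (bottom M)
  bottom-flat = flat-intro {bottom M} (λ e e∉b → subst (_< rk M (bottom M ∪ ⁅ e ⁆)) (sym rk-bottom)
    (ℕP.<-≤-trans (ℕP.n≢0⇒n>0 (λ h → e∉b (loop⇒∈bottom h))) (rk-mono M (q⊆p∪q (bottom M) ⁅ e ⁆))))

  -- A loop outside `F` would have to raise the rank by flatness, which subadditivity forbids.
  bottom-⊆ᵇ : ∀ {F} → Flat F → (bottom M ⊆ᵇ F) ≡ true
  bottom-⊆ᵇ {F} fF = ⊆ᵇ-true⁺ {X = bottom M} {F} member
    where
    member : bottom M ⊆ F
    member {e} m with e ∈? F
    ... | yes e∈F = e∈F
    ... | no  e∉F = ⊥-elim (ℕP.<⇒≱ (flat-insert fF e∉F) (ℕP.≤-trans (rk-∪-≤ F ⁅ e ⁆)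
                      (ℕP.≤-reflexive (trans (cong (rk M F +_) (∈bottom⇒loop m)) (ℕP.+-identityʳ _)))))

  ∑-flats-cong : ∀ {f g : Subset n → ℤ} → (∀ F → Flat F → f F ≡ g F) → ∑ (flats M) f ≡ ∑ (flats M) g
  ∑-flats-cong = ∑-cong-filterᵇ (isFlat M) (allSubsets n)

  ∑-flats-δ : ∀ {G} → Flat G → (f : Subset n → ℤ) → (∑[ F ∈ flats M ] ι (F ≟ˢ G) *ᶻ f F) ≡ f G
  ∑-flats-δ {G} fG f = begin
    (∑[ F ∈ flats M ] ι (F ≟ˢ G) *ᶻ f F)                          ≡⟨ ∑-filterᵇ (isFlat M) (allSubsets n) _ ⟩
    (∑[ F ∈ allSubsets n ] ι (isFlat M F) *ᶻ (ι (F ≟ˢ G) *ᶻ f F)) ≡⟨ ∑-cong (allSubsets n) (λ F → left-comm (ι (isFlat M F)) (ι (F ≟ˢ G)) (f F)) ⟩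
    (∑[ F ∈ allSubsets n ] ι (F ≟ˢ G) *ᶻ (ι (isFlat M F) *ᶻ f F)) ≡⟨ ∑-allSubsets-δ G (λ F → ι (isFlat M F) *ᶻ f F) ⟩
    ι (isFlat M G) *ᶻ f G                                         ≡⟨ ι-true (f G) fG ⟩
    f G                                                           ∎
    where
    open ≡-Reasoning
    left-comm : ∀ a b c → a *ᶻ (b *ᶻ c) ≡ b *ᶻ (a *ᶻ c)
    left-comm = solve-∀

-- Möbius inversion and the palindromicity of the Z-polynomial

module _ {n : ℕ} (M : Matroid n) where

  private
    L : List (Subset n)
    L = flats M

  ∑-interval : ∀ F G (f : Subset n → ℤ) →
    ∑ (interval M F G) f ≡ (∑[ K ∈ L ] ι (F ⊆ᵇ K) *ᶻ (ι (K ⊆ᵇ G) *ᶻ f K))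
  ∑-interval F G f = trans (∑-filterᵇ (λ K → (F ⊆ᵇ K) ∧ (K ⊆ᵇ G)) L f)
    (∑-cong L (λ K → trans (cong (_*ᶻ f K) (ι-∧ (F ⊆ᵇ K) (K ⊆ᵇ G))) (ℤP.*-assoc (ι (F ⊆ᵇ K)) (ι (K ⊆ᵇ G)) (f K))))

  ∑-interval-cong : ∀ F G {f g : Subset n → ℤ} →
    (∀ K → Flat M K → (F ⊆ᵇ K) ≡ true → (K ⊆ᵇ G) ≡ true → f K ≡ g K) → ∑ (interval M F G) f ≡ ∑ (interval M F G) g
  ∑-interval-cong F G {f} {g} h = trans (∑-interval F G f) (trans
    (∑-flats-cong M (λ K fK → ι-cong (λ F⊆K → ι-cong (λ K⊆G → h K fK F⊆K K⊆G))))
    (sym (∑-interval F G g)))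

  -- Each recursive call passes to a flat of strictly smaller rank, so any fuel above the rank of
  -- `G` gives the same value. This is needed to read the definition of `mobius` as a recursion,
  -- because its inner calls run with one unit of fuel less.
  mobius′-fuel : ∀ f f′ {F G} → Flat M G → rk M G < f → rk M G < f′ → mobius′ M f F G ≡ mobius′ M f′ F G
  mobius′-fuel (suc f) (suc f′) {F} {G} fG (s≤s r) (s≤s r′) with F ≟ˢ G
  ... | true  = refl
  ... | false with F ⊆ᵇ G
  ...   | false = refl
  ...   | true  = cong -ᶻ_ (trans (∑-filterᵇ (λ K → not (K ≟ˢ G)) (interval M F G) (mobius′ M f F))
        (trans (∑-interval-cong F G (λ K fK _ K⊆G → ι-cong (λ K≠G →
            let s = strict fK K⊆G K≠G in mobius′-fuel f f′ fK (ℕP.<-≤-trans s r) (ℕP.<-≤-trans s r′))))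
          (sym (∑-filterᵇ (λ K → not (K ≟ˢ G)) (interval M F G) (mobius′ M f′ F)))))
    where
    strict : ∀ {K} → Flat M K → (K ⊆ᵇ G) ≡ true → not (K ≟ˢ G) ≡ true → rk M K < rk M G
    strict {K} fK K⊆G K≠G = ℕP.≰⇒> (λ r → not-true (subst (λ X → (K ≟ˢ X) ≡ true) (rk-strict M fK K⊆G r) (≟ˢ-refl K)) K≠G)
      where
      not-true : ∀ {b} → b ≡ true → ¬ not b ≡ true
      not-true refl ()

  mobius-refl : ∀ F → mobius M F F ≡ 1ℤ
  mobius-refl F rewrite ≟ˢ-refl F = refl

  rk<suc-n : ∀ F → rk M F < suc n
  rk<suc-n F = s≤s (ℕP.≤-trans (rk-bound M F) (∣p∣≤n F))

  mobius-rec : ∀ {F G} → (F ≟ˢ G) ≡ false → (F ⊆ᵇ G) ≡ true →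
    mobius M F G ≡ -ᶻ (∑[ K ∈ interval M F G ] ι (not (K ≟ˢ G)) *ᶻ mobius M F K)
  mobius-rec {F} {G} F≠G F⊆G rewrite F≠G | F⊆G = cong -ᶻ_
    (trans (∑-filterᵇ (λ K → not (K ≟ˢ G)) (interval M F G) (mobius′ M (suc n) F))
      (∑-interval-cong F G (λ K fK _ _ → cong (ι (not (K ≟ˢ G)) *ᶻ_)
        (mobius′-fuel (suc n) (suc (suc n)) fK (rk<suc-n K) (ℕP.m<n⇒m<1+n (rk<suc-n K))))))

  ∑-mobius-≰ : ∀ {F G} → ¬ (F ⊆ᵇ G) ≡ true → ∑ (interval M F G) (mobius M F) ≡ 0ℤ
  ∑-mobius-≰ {F} {G} F⊈G = trans (∑-interval F G _) (∑-zero L (λ K → trans (ι-cong (λ F⊆K → ι-false (mobius M F K)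
    (λ K⊆G → F⊈G (⊆ᵇ-trans {X = F} {K} {G} F⊆K K⊆G)))) (ℤP.*-zeroʳ (ι (F ⊆ᵇ K)))))

  ∑-mobius-< : ∀ {F G} → Flat M G → (F ≟ˢ G) ≡ false → (F ⊆ᵇ G) ≡ true → ∑ (interval M F G) (mobius M F) ≡ 0ℤ
  ∑-mobius-< {F} {G} fG F≠G F⊆G = begin
    ∑ I (mobius M F)                                                    ≡⟨ ∑-cong I (λ K → split (K ≟ˢ G) (mobius M F K)) ⟩
    (∑[ K ∈ I ] (ι (not (K ≟ˢ G)) *ᶻ mobius M F K +ᶻ ι (K ≟ˢ G) *ᶻ mobius M F K)) ≡⟨ ∑-+ I _ _ ⟩
    S +ᶻ (∑[ K ∈ I ] ι (K ≟ˢ G) *ᶻ mobius M F K)                        ≡⟨ cong (S +ᶻ_) (∑-interval F G _) ⟩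
    S +ᶻ (∑[ K ∈ L ] ι (F ⊆ᵇ K) *ᶻ (ι (K ⊆ᵇ G) *ᶻ (ι (K ≟ˢ G) *ᶻ mobius M F K)))
      ≡⟨ cong (S +ᶻ_) (∑-cong L (λ K → rotate (ι (F ⊆ᵇ K)) (ι (K ⊆ᵇ G)) (ι (K ≟ˢ G)) (mobius M F K))) ⟩
    S +ᶻ (∑[ K ∈ L ] ι (K ≟ˢ G) *ᶻ (ι (F ⊆ᵇ K) *ᶻ (ι (K ⊆ᵇ G) *ᶻ mobius M F K)))
      ≡⟨ cong (S +ᶻ_) (∑-flats-δ M fG (λ K → ι (F ⊆ᵇ K) *ᶻ (ι (K ⊆ᵇ G) *ᶻ mobius M F K))) ⟩
    S +ᶻ ι (F ⊆ᵇ G) *ᶻ (ι (G ⊆ᵇ G) *ᶻ mobius M F G)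
      ≡⟨ cong (S +ᶻ_) (trans (ι-true _ F⊆G) (ι-true _ (⊆ᵇ-refl G))) ⟩
    S +ᶻ mobius M F G                                                   ≡⟨ cong (S +ᶻ_) (mobius-rec {F} {G} F≠G F⊆G) ⟩
    S +ᶻ -ᶻ S                                                           ≡⟨ ℤP.+-inverseʳ S ⟩
    0ℤ                                                                  ∎
    where
    open ≡-Reasoning
    I : List (Subset n)
    I = interval M F G
    S : ℤ
    S = ∑[ K ∈ I ] ι (not (K ≟ˢ G)) *ᶻ mobius M F K
    split : ∀ b x → x ≡ ι (not b) *ᶻ x +ᶻ ι b *ᶻ x
    split true  = solve-∀
    split false = solve-∀
    rotate : ∀ a b c d → a *ᶻ (b *ᶻ (c *ᶻ d)) ≡ c *ᶻ (a *ᶻ (b *ᶻ d))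
    rotate = solve-∀

  ∑-mobius-refl : ∀ {F} → Flat M F → ∑ (interval M F F) (mobius M F) ≡ 1ℤ
  ∑-mobius-refl {F} fF = begin
    ∑ (interval M F F) (mobius M F)                       ≡⟨ ∑-filterᵇ (λ K → (F ⊆ᵇ K) ∧ (K ⊆ᵇ F)) L (mobius M F) ⟩
    (∑[ K ∈ L ] ι ((F ⊆ᵇ K) ∧ (K ⊆ᵇ F)) *ᶻ mobius M F K)  ≡⟨ ∑-cong L (λ K → cong (λ b → ι b *ᶻ mobius M F K) (∧-comm (F ⊆ᵇ K) (K ⊆ᵇ F))) ⟩
    (∑[ K ∈ L ] ι (K ≟ˢ F) *ᶻ mobius M F K)               ≡⟨ ∑-flats-δ M fF (mobius M F) ⟩
    mobius M F F                                          ≡⟨ mobius-refl F ⟩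
    1ℤ                                                    ∎
    where open ≡-Reasoning

  ∑-mobius : ∀ {F G} → Flat M F → Flat M G → ∑ (interval M F G) (mobius M F) ≡ ι (F ≟ˢ G)
  ∑-mobius {F} {G} fF fG with true-or-false (F ≟ˢ G) | true-or-false (F ⊆ᵇ G)
  ... | inj₁ F=G | _        = trans (subst (λ X → ∑ (interval M F X) (mobius M F) ≡ 1ℤ) (≟ˢ-true⁻ {X = F} {G} F=G) (∑-mobius-refl fF)) (sym (cong ι F=G))
  ... | inj₂ F≠G | inj₁ F⊆G = trans (∑-mobius-< {F} {G} fG F≠G F⊆G) (sym (cong ι F≠G))
  ... | inj₂ F≠G | inj₂ F⊈G = trans (∑-mobius-≰ {F} {G} (false≢true F⊈G)) (sym (cong ι F≠G))

  -- The incidence matrix μ is unitriangular, hence has trivial kernel.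
  mobius-injective : ∀ (d : Subset n → ℤ) →
    (∀ F → Flat M F → (∑[ K ∈ L ] ι (F ⊆ᵇ K) *ᶻ (mobius M F K *ᶻ d K)) ≡ 0ℤ) → ∀ F → Flat M F → d F ≡ 0ℤ
  mobius-injective d ker F fF = go (suc (crk M F)) F fF ℕP.≤-refl
    where
    go : ∀ b F → Flat M F → crk M F < b → d F ≡ 0ℤ
    go (suc b) F fF (s≤s r) = trans (sym (trans (cong (_*ᶻ d F) (mobius-refl F)) (ℤP.*-identityˡ (d F)))) (begin
      mobius M F F *ᶻ d F                                        ≡⟨ ∑-flats-δ M fF (λ K → mobius M F K *ᶻ d K) ⟨
      (∑[ K ∈ L ] ι (K ≟ˢ F) *ᶻ (mobius M F K *ᶻ d K))            ≡⟨ ∑-flats-cong M only-F ⟨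
      (∑[ K ∈ L ] ι (F ⊆ᵇ K) *ᶻ (mobius M F K *ᶻ d K))            ≡⟨ ker F fF ⟩
      0ℤ                                                         ∎)
      where
      open ≡-Reasoning
      -- Flats strictly above `F` have smaller corank, so `d` vanishes there by induction; the
      -- kernel equation at `F` is reduced to its diagonal term.
      only-F : ∀ K → Flat M K → ι (F ⊆ᵇ K) *ᶻ (mobius M F K *ᶻ d K) ≡ ι (K ≟ˢ F) *ᶻ (mobius M F K *ᶻ d K)
      only-F K fK with K ≟ˢ F in eq
      ... | true with refl ← ≟ˢ-true⁻ {X = K} {F} eq = trans (ι-true (mobius M F F *ᶻ d F) (⊆ᵇ-refl F)) (sym (ℤP.*-identityˡ (mobius M F F *ᶻ d F)))
      ... | false = trans (ι-cong {y = 0ℤ} (λ F⊆K → trans (cong (mobius M F K *ᶻ_) (go b K fK (smaller F⊆K))) (ℤP.*-zeroʳ (mobius M F K))))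
                      (trans (ℤP.*-zeroʳ (ι (F ⊆ᵇ K))) (sym (ℤP.*-zeroˡ (mobius M F K *ᶻ d K))))
        where
        smaller : (F ⊆ᵇ K) ≡ true → crk M K < b
        smaller F⊆K = ℕP.<-≤-trans (ℕP.∸-monoʳ-< (ℕP.≰⇒> larger) (rk-≤-rkM M K)) r
          where
          larger : ¬ rk M K ≤ rk M F
          larger le with refl ← rk-strict M fF F⊆K le with () ← trans (sym (≟ˢ-refl F)) eq

module _ {n : ℕ} (M : Matroid n) (P : Subset n → Subset n → ℕ → ℤ) (kl : IsKL M P) where

  private
    L : List (Subset n)
    L = flats M

  -- The coefficients of the Kazhdan–Lusztig polynomial of the contraction M^F.
  c : Subset n → ℕ → ℤ
  c F = P F ⊤

  rev : Subset n → ℕ → ℤ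
  rev F = polyRev (crk M F) (c F)

  -- The guard discards degrees below the shift, where truncated subtraction would wrongly read the
  -- constant term.
  shift : Subset n → Subset n → ℕ → ℤ
  shift F H k = ι ((rk M H ∸ rk M F) <ᵇ suc k) *ᶻ c H (k ∸ (rk M H ∸ rk M F))

  -- The coefficients of Z(t) = ∑_{H ≥ F} t^(rk H - rk F) P_{M^H}(t), and of ∑_{H ≥ F} t^(crk H) P_{M^H}(1/t).
  Z Zrev : Subset n → ℕ → ℤ
  Z    F k = ∑[ H ∈ L ] ι (F ⊆ᵇ H) *ᶻ shift F H k
  Zrev F k = ∑[ H ∈ L ] ι (F ⊆ᵇ H) *ᶻ rev H k

  -- Each `K` puts `mobius M F K` in degree rk H - rk K of the characteristic polynomial, so in the
  -- product it shifts P_{M^H} by that amount. This is the summand of `Z K` belonging to `H`.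
  charPoly-mul : ∀ F H k →
    polyMul (charPoly M F H) (c H) k ≡ (∑[ K ∈ interval M F H ] mobius M F K *ᶻ shift K H k)
  charPoly-mul F H k = begin
    (∑[ m ∈ U ] charPoly M F H m *ᶻ c H (k ∸ m))
      ≡⟨ ∑-cong U (λ m → cong (_*ᶻ c H (k ∸ m)) (∑-filterᵇ (λ K → (rk M H ∸ rk M K) ≡ᵇ m) I (mobius M F))) ⟩
    (∑[ m ∈ U ] (∑[ K ∈ I ] ι ((rk M H ∸ rk M K) ≡ᵇ m) *ᶻ mobius M F K) *ᶻ c H (k ∸ m))
      ≡⟨ ∑-cong U (λ m → sym (∑-*ʳ I (c H (k ∸ m)) (λ K → ι ((rk M H ∸ rk M K) ≡ᵇ m) *ᶻ mobius M F K))) ⟩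
    (∑[ m ∈ U ] ∑[ K ∈ I ] ι ((rk M H ∸ rk M K) ≡ᵇ m) *ᶻ mobius M F K *ᶻ c H (k ∸ m))
      ≡⟨ ∑-swap U I (λ m K → ι ((rk M H ∸ rk M K) ≡ᵇ m) *ᶻ mobius M F K *ᶻ c H (k ∸ m)) ⟩
    (∑[ K ∈ I ] ∑[ m ∈ U ] ι ((rk M H ∸ rk M K) ≡ᵇ m) *ᶻ mobius M F K *ᶻ c H (k ∸ m))
      ≡⟨ ∑-cong I (λ K → ∑-cong U (λ m → ℤP.*-assoc (ι ((rk M H ∸ rk M K) ≡ᵇ m)) (mobius M F K) (c H (k ∸ m)))) ⟩
    (∑[ K ∈ I ] ∑[ m ∈ U ] ι ((rk M H ∸ rk M K) ≡ᵇ m) *ᶻ (mobius M F K *ᶻ c H (k ∸ m)))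
      ≡⟨ ∑-cong I (λ K → ∑-upTo-δ (suc k) (rk M H ∸ rk M K) (λ m → mobius M F K *ᶻ c H (k ∸ m))) ⟩
    (∑[ K ∈ I ] ι ((rk M H ∸ rk M K) <ᵇ suc k) *ᶻ (mobius M F K *ᶻ c H (k ∸ (rk M H ∸ rk M K))))
      ≡⟨ ∑-cong I (λ K → left-comm (ι ((rk M H ∸ rk M K) <ᵇ suc k)) (mobius M F K) (c H (k ∸ (rk M H ∸ rk M K)))) ⟩
    (∑[ K ∈ I ] mobius M F K *ᶻ shift K H k) ∎
    where
    open ≡-Reasoning
    I : List (Subset n)
    I = interval M F H
    U : List ℕ
    U = upTo (suc k)
    left-comm : ∀ a b d → a *ᶻ (b *ᶻ d) ≡ b *ᶻ (a *ᶻ d)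
    left-comm = solve-∀

  -- In the defining identity at `F`, collecting everything that multiplies `mobius M F K` leaves a
  -- sum over all flats `H` above `K`, which is `Z K`.
  rev-Z : ∀ F → Flat M F → ∀ k → rev F k ≡ (∑[ K ∈ L ] ι (F ⊆ᵇ K) *ᶻ (mobius M F K *ᶻ Z K k))
  rev-Z F fF k = begin
    rev F k
      ≡⟨ proj₂ (proj₂ (kl F ⊤ fF (⊤-flat M) (⊆ᵇ-⊤ F))) k ⟩
    (∑[ H ∈ interval M F ⊤ ] polyMul (charPoly M F H) (c H) k)
      ≡⟨ ∑-cong (interval M F ⊤) (λ H → charPoly-mul F H k) ⟩
    (∑[ H ∈ interval M F ⊤ ] ∑[ K ∈ interval M F H ] mobius M F K *ᶻ shift K H k)
      ≡⟨ ∑-cong (interval M F ⊤) (λ H → ∑-interval M F H (λ K → mobius M F K *ᶻ shift K H k)) ⟩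
    (∑[ H ∈ interval M F ⊤ ] ∑[ K ∈ L ] term H K)
      ≡⟨ ∑-interval M F ⊤ (λ H → ∑[ K ∈ L ] term H K) ⟩
    (∑[ H ∈ L ] ι (F ⊆ᵇ H) *ᶻ (ι (H ⊆ᵇ ⊤) *ᶻ (∑[ K ∈ L ] term H K)))
      ≡⟨ ∑-cong L (λ H → trans (cong (ι (F ⊆ᵇ H) *ᶻ_) (sym (∑-*ˡ L (ι (H ⊆ᵇ ⊤)) (term H))))
                             (sym (∑-*ˡ L (ι (F ⊆ᵇ H)) (λ K → ι (H ⊆ᵇ ⊤) *ᶻ term H K)))) ⟩
    (∑[ H ∈ L ] ∑[ K ∈ L ] ι (F ⊆ᵇ H) *ᶻ (ι (H ⊆ᵇ ⊤) *ᶻ term H K))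
      ≡⟨ ∑-swap L L (λ H K → ι (F ⊆ᵇ H) *ᶻ (ι (H ⊆ᵇ ⊤) *ᶻ term H K)) ⟩
    (∑[ K ∈ L ] ∑[ H ∈ L ] ι (F ⊆ᵇ H) *ᶻ (ι (H ⊆ᵇ ⊤) *ᶻ term H K))
      ≡⟨ ∑-cong L (λ K → ∑-cong L (λ H → drop-redundant H K)) ⟩
    (∑[ K ∈ L ] ∑[ H ∈ L ] ι (F ⊆ᵇ K) *ᶻ (mobius M F K *ᶻ (ι (K ⊆ᵇ H) *ᶻ shift K H k)))
      ≡⟨ ∑-cong L (λ K → trans (∑-*ˡ L (ι (F ⊆ᵇ K)) (λ H → mobius M F K *ᶻ (ι (K ⊆ᵇ H) *ᶻ shift K H k)))
                             (cong (ι (F ⊆ᵇ K) *ᶻ_) (∑-*ˡ L (mobius M F K) (λ H → ι (K ⊆ᵇ H) *ᶻ shift K H k)))) ⟩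
    (∑[ K ∈ L ] ι (F ⊆ᵇ K) *ᶻ (mobius M F K *ᶻ Z K k)) ∎
    where
    open ≡-Reasoning
    term : Subset n → Subset n → ℤ
    term H K = ι (F ⊆ᵇ K) *ᶻ (ι (K ⊆ᵇ H) *ᶻ (mobius M F K *ᶻ shift K H k))
    reorder : ∀ a b d e f → a *ᶻ (b *ᶻ (d *ᶻ (e *ᶻ f))) ≡ d *ᶻ (e *ᶻ (a *ᶻ (b *ᶻ f)))
    reorder = solve-∀
    left-comm : ∀ a b d → a *ᶻ (b *ᶻ d) ≡ b *ᶻ (a *ᶻ d)
    left-comm = solve-∀
    drop-redundant : ∀ H K → ι (F ⊆ᵇ H) *ᶻ (ι (H ⊆ᵇ ⊤) *ᶻ term H K) ≡
      ι (F ⊆ᵇ K) *ᶻ (mobius M F K *ᶻ (ι (K ⊆ᵇ H) *ᶻ shift K H k))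
    drop-redundant H K = trans
      (reorder (ι (F ⊆ᵇ H)) (ι (H ⊆ᵇ ⊤)) (ι (F ⊆ᵇ K)) (ι (K ⊆ᵇ H)) (mobius M F K *ᶻ shift K H k))
      (ι-cong (λ F⊆K → trans
        (ι-cong (λ K⊆H → trans (ι-true (ι (H ⊆ᵇ ⊤) *ᶻ (mobius M F K *ᶻ shift K H k)) (⊆ᵇ-trans {X = F} {K} {H} F⊆K K⊆H))
                               (ι-true (mobius M F K *ᶻ shift K H k) (⊆ᵇ-⊤ H))))
        (left-comm (ι (K ⊆ᵇ H)) (mobius M F K) (shift K H k))))

  -- Pure Möbius inversion: after the sums are exchanged, the inner sum of `mobius M F K` over the
  -- interval from `F` to `H` is δ.
  rev-Zrev : ∀ F → Flat M F → ∀ k → rev F k ≡ (∑[ K ∈ L ] ι (F ⊆ᵇ K) *ᶻ (mobius M F K *ᶻ Zrev K k))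
  rev-Zrev F fF k = sym (begin
    (∑[ K ∈ L ] ι (F ⊆ᵇ K) *ᶻ (mobius M F K *ᶻ Zrev K k))
      ≡⟨ ∑-cong L (λ K → trans (cong (ι (F ⊆ᵇ K) *ᶻ_) (sym (∑-*ˡ L (mobius M F K) (λ H → ι (K ⊆ᵇ H) *ᶻ rev H k))))
                             (sym (∑-*ˡ L (ι (F ⊆ᵇ K)) (λ H → mobius M F K *ᶻ (ι (K ⊆ᵇ H) *ᶻ rev H k))))) ⟩
    (∑[ K ∈ L ] ∑[ H ∈ L ] ι (F ⊆ᵇ K) *ᶻ (mobius M F K *ᶻ (ι (K ⊆ᵇ H) *ᶻ rev H k)))
      ≡⟨ ∑-swap L L (λ K H → ι (F ⊆ᵇ K) *ᶻ (mobius M F K *ᶻ (ι (K ⊆ᵇ H) *ᶻ rev H k))) ⟩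
    (∑[ H ∈ L ] ∑[ K ∈ L ] ι (F ⊆ᵇ K) *ᶻ (mobius M F K *ᶻ (ι (K ⊆ᵇ H) *ᶻ rev H k)))
      ≡⟨ ∑-cong L (λ H → ∑-cong L (λ K → reorder (ι (F ⊆ᵇ K)) (mobius M F K) (ι (K ⊆ᵇ H)) (rev H k))) ⟩
    (∑[ H ∈ L ] ∑[ K ∈ L ] ι (F ⊆ᵇ K) *ᶻ (ι (K ⊆ᵇ H) *ᶻ mobius M F K) *ᶻ rev H k)
      ≡⟨ ∑-cong L (λ H → ∑-*ʳ L (rev H k) (λ K → ι (F ⊆ᵇ K) *ᶻ (ι (K ⊆ᵇ H) *ᶻ mobius M F K))) ⟩
    (∑[ H ∈ L ] (∑[ K ∈ L ] ι (F ⊆ᵇ K) *ᶻ (ι (K ⊆ᵇ H) *ᶻ mobius M F K)) *ᶻ rev H k)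
      ≡⟨ ∑-flats-cong M (λ H fH → cong (_*ᶻ rev H k) (trans (sym (∑-interval M F H (mobius M F))) (trans (∑-mobius M fF fH) (cong ι (∧-comm (F ⊆ᵇ H) (H ⊆ᵇ F)))))) ⟩
    (∑[ H ∈ L ] ι (H ≟ˢ F) *ᶻ rev H k)
      ≡⟨ ∑-flats-δ M fF (λ H → rev H k) ⟩
    rev F k ∎)
    where
    open ≡-Reasoning
    reorder : ∀ a b d e → a *ᶻ (b *ᶻ (d *ᶻ e)) ≡ a *ᶻ (d *ᶻ b) *ᶻ e
    reorder = solve-∀

  -- Both sides have the image `rev` under μ, so their difference lies in its kernel. This is
  -- palindromicity because crk F - (rk H - rk F) = crk H for `H` above `F`, which makes `Zrev F`
  -- the reversal of `Z F` in degree crk F.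
  Z-palindromic : ∀ F → Flat M F → ∀ k → Z F k ≡ Zrev F k
  Z-palindromic F fF k = ℤP.i-j≡0⇒i≡j (Z F k) (Zrev F k) (mobius-injective M (λ K → Z K k -ᶻ Zrev K k) kernel F fF)
    where
    open ≡-Reasoning
    distrib : ∀ a b x y → a *ᶻ (b *ᶻ (x -ᶻ y)) ≡ a *ᶻ (b *ᶻ x) -ᶻ a *ᶻ (b *ᶻ y)
    distrib = solve-∀
    kernel : ∀ F → Flat M F → (∑[ K ∈ L ] ι (F ⊆ᵇ K) *ᶻ (mobius M F K *ᶻ (Z K k -ᶻ Zrev K k))) ≡ 0ℤ
    kernel F fF = begin
      (∑[ K ∈ L ] ι (F ⊆ᵇ K) *ᶻ (mobius M F K *ᶻ (Z K k -ᶻ Zrev K k)))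
        ≡⟨ ∑-cong L (λ K → distrib (ι (F ⊆ᵇ K)) (mobius M F K) (Z K k) (Zrev K k)) ⟩
      (∑[ K ∈ L ] (ι (F ⊆ᵇ K) *ᶻ (mobius M F K *ᶻ Z K k) -ᶻ ι (F ⊆ᵇ K) *ᶻ (mobius M F K *ᶻ Zrev K k)))
        ≡⟨ ∑-- L (λ K → ι (F ⊆ᵇ K) *ᶻ (mobius M F K *ᶻ Z K k)) (λ K → ι (F ⊆ᵇ K) *ᶻ (mobius M F K *ᶻ Zrev K k)) ⟩
      (∑[ K ∈ L ] ι (F ⊆ᵇ K) *ᶻ (mobius M F K *ᶻ Z K k)) -ᶻ (∑[ K ∈ L ] ι (F ⊆ᵇ K) *ᶻ (mobius M F K *ᶻ Zrev K k))
        ≡⟨ cong₂ _-ᶻ_ (sym (rev-Z F fF k)) (sym (rev-Zrev F fF k)) ⟩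
      rev F k -ᶻ rev F k
        ≡⟨ ℤP.i≡j⇒i-j≡0 {rev F k} refl ⟩
      0ℤ ∎

-- The recursion for the coefficients

module _ {n : ℕ} (M : Matroid n) where

  private
    L : List (Subset n)
    L = flats M
    X : List ℕ
    X = upTo (suc (rkM M))

  step : (Subset n → ℕ → ℕ → ℤ) → Subset n → ℕ → ℕ → ℤ
  step T F t i = ∑[ x ∈ X ] ι (x <ᵇ i) *ᶻ (∑[ G ∈ L ] ι (F ⊆ᵇ G) *ᶻ
    (ι (crk M G ≡ᵇ i + x) *ᶻ T G i x -ᶻ ι (crk M G ≡ᵇ t + x) *ᶻ T G t x))

  -- The signed count of the chains above F that have length r and whose index sequence
  -- ends in a_r = i, a_{r+1} = t.
  E : ℕ → Subset n → ℕ → ℕ → ℤ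
  E zero    F t i = ι (i ≡ᵇ 0)
  E (suc r) F t i = step (E r) F t i

  -- Agreement is required only where the indicators are nonzero. The hypotheses made available
  -- there are what an induction along the recursion needs at the new arguments.
  step-cong : ∀ {T T′ F t i} →
    (∀ G x → Flat M G → x < i → crk M G ≡ i + x → T G i x ≡ T′ G i x) →
    (∀ G x → Flat M G → x < i → crk M G ≡ t + x → T G t x ≡ T′ G t x) → step T F t i ≡ step T′ F t i
  step-cong {F = F} hi ht = ∑-cong X (λ x → ι-cong (λ x<i → ∑-flats-cong M (λ G fG → cong (ι (F ⊆ᵇ G) *ᶻ_)
    (cong₂ _-ᶻ_ (ι-cong (λ e → hi G x fG (<ᵇ-true⁻ x<i) (≡ᵇ-true⁻ e))) (ι-cong (λ e → ht G x fG (<ᵇ-true⁻ x<i) (≡ᵇ-true⁻ e)))))))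

  step-0 : ∀ F t i → step (λ _ _ _ → 0ℤ) F t i ≡ 0ℤ
  step-0 F t i = ∑-zero X (λ x → trans (cong (ι (x <ᵇ i) *ᶻ_) (∑-zero L (λ G →
      vanish (ι (F ⊆ᵇ G)) (ι (crk M G ≡ᵇ i + x)) (ι (crk M G ≡ᵇ t + x))))) (ℤP.*-zeroʳ (ι (x <ᵇ i))))
    where
    vanish : ∀ a b d → a *ᶻ (b *ᶻ 0ℤ -ᶻ d *ᶻ 0ℤ) ≡ 0ℤ
    vanish = solve-∀

  step-at-0 : ∀ T F t → step T F t 0 ≡ 0ℤ
  step-at-0 T F t = ∑-zero X (λ x → ℤP.*-zeroˡ (∑[ G ∈ L ] ι (F ⊆ᵇ G) *ᶻ
    (ι (crk M G ≡ᵇ x) *ᶻ T G 0 x -ᶻ ι (crk M G ≡ᵇ t + x) *ᶻ T G t x)))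

  step-+ : ∀ T T′ F t i → step (λ G u x → T G u x +ᶻ T′ G u x) F t i ≡ step T F t i +ᶻ step T′ F t i
  step-+ T T′ F t i = trans (∑-cong X (λ x → trans (cong (ι (x <ᵇ i) *ᶻ_) (trans
        (∑-cong L (λ G → regroup (ι (F ⊆ᵇ G)) (ι (crk M G ≡ᵇ i + x)) (ι (crk M G ≡ᵇ t + x)) (T G i x) (T′ G i x) (T G t x) (T′ G t x)))
        (∑-+ L (λ G → summand T x G) (λ G → summand T′ x G))))
      (ℤP.*-distribˡ-+ (ι (x <ᵇ i)) (∑[ G ∈ L ] summand T x G) (∑[ G ∈ L ] summand T′ x G))))
    (∑-+ X (λ x → ι (x <ᵇ i) *ᶻ (∑[ G ∈ L ] summand T x G)) (λ x → ι (x <ᵇ i) *ᶻ (∑[ G ∈ L ] summand T′ x G)))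
    where
    summand : (Subset n → ℕ → ℕ → ℤ) → ℕ → Subset n → ℤ
    summand T x G = ι (F ⊆ᵇ G) *ᶻ (ι (crk M G ≡ᵇ i + x) *ᶻ T G i x -ᶻ ι (crk M G ≡ᵇ t + x) *ᶻ T G t x)
    regroup : ∀ a b d p q r s → a *ᶻ (b *ᶻ (p +ᶻ q) -ᶻ d *ᶻ (r +ᶻ s)) ≡
      a *ᶻ (b *ᶻ p -ᶻ d *ᶻ r) +ᶻ a *ᶻ (b *ᶻ q -ᶻ d *ᶻ s)
    regroup = solve-∀

  -- Linearity of `step` is used on both sides of the formula: for the sum over depths on the side
  -- of the coefficients, and for the sums over index sequences and over subsets on the side of the
  -- chains.
  step-∑ : ∀ {A : Set} (l : List A) (T : A → Subset n → ℕ → ℕ → ℤ) F t i →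
    (∑[ r ∈ l ] step (T r) F t i) ≡ step (λ G u x → ∑[ r ∈ l ] T r G u x) F t i
  step-∑ []      T F t i = sym (step-0 F t i)
  step-∑ (r ∷ l) T F t i = trans (cong (step (T r) F t i +ᶻ_) (step-∑ l T F t i))
    (sym (step-+ (T r) (λ G u x → ∑[ s ∈ l ] T s G u x) F t i))

  -- For `i ≤ rkM M` this is `f (m ∸ j)` if `j ≤ m < j + i`, and zero otherwise. Written as a sum
  -- over `x`, it is what remains of `step` at one flat of corank `m`.
  pick : ℕ → ℕ → ℕ → (ℕ → ℤ) → ℤ
  pick m j i f = ∑[ x ∈ X ] ι (x <ᵇ i) *ᶻ (ι (m ≡ᵇ j + x) *ᶻ f x)

  pick-hit : ∀ {m} j i {y} f → y < i → i ≤ rkM M → m ≡ j + y → pick m j i f ≡ f y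
  pick-hit {m} j i {y} f y<i i≤R refl = begin
    pick m j i f                    ≡⟨ ∑-cong X pointwise ⟩
    (∑[ x ∈ X ] ι (y ≡ᵇ x) *ᶻ f x)  ≡⟨ ∑-upTo-δ (suc (rkM M)) y f ⟩
    ι (y <ᵇ suc (rkM M)) *ᶻ f y     ≡⟨ ι-true (f y) (<ᵇ-true⁺ (ℕP.m<n⇒m<1+n (ℕP.<-≤-trans y<i i≤R))) ⟩
    f y                             ∎
    where
    open ≡-Reasoning
    same : ∀ x → (y ≡ᵇ x) ≡ (x <ᵇ i) ∧ (j + y ≡ᵇ j + x)
    same x = ⟺⇒≡
      ( (λ e → let y≡x = ≡ᵇ-true⁻ {y} {x} e in ∧-true⁺ (<ᵇ-true⁺ (subst (_< i) y≡x y<i)) (≡ᵇ-true⁺ (cong (j +_) y≡x)))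
      , (λ e → ≡ᵇ-true⁺ (ℕP.+-cancelˡ-≡ j y x (≡ᵇ-true⁻ (proj₂ (∧-true⁻ {x <ᵇ i} e))))))
    pointwise : ∀ x → ι (x <ᵇ i) *ᶻ (ι (j + y ≡ᵇ j + x) *ᶻ f x) ≡ ι (y ≡ᵇ x) *ᶻ f x
    pointwise x = trans (sym (ℤP.*-assoc (ι (x <ᵇ i)) (ι (j + y ≡ᵇ j + x)) (f x)))
      (cong (_*ᶻ f x) (trans (sym (ι-∧ (x <ᵇ i) (j + y ≡ᵇ j + x))) (cong ι (sym (same x)))))

  pick-miss : ∀ m j i f → (∀ x → x < i → ¬ m ≡ j + x) → pick m j i f ≡ 0ℤ
  pick-miss m j i f h = ∑-zero X (λ x → trans
    (ι-cong {y = 0ℤ} (λ x<i → ι-false (f x) (λ e → h x (<ᵇ-true⁻ x<i) (≡ᵇ-true⁻ e)))) (ℤP.*-zeroʳ (ι (x <ᵇ i))))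

  -- When the family does not depend on `t`, the two halves of `step` separate into sums over flats,
  -- the form in which the coefficients of `Z` and `Zrev` appear.
  step-pick : ∀ (f : Subset n → ℕ → ℤ) F t i → step (λ G _ x → f G x) F t i ≡
    (∑[ G ∈ L ] ι (F ⊆ᵇ G) *ᶻ pick (crk M G) i i (f G)) -ᶻ (∑[ G ∈ L ] ι (F ⊆ᵇ G) *ᶻ pick (crk M G) t i (f G))
  step-pick f F t i = begin
    (∑[ x ∈ X ] ι (x <ᵇ i) *ᶻ (∑[ G ∈ L ] ι (F ⊆ᵇ G) *ᶻ (term i x G -ᶻ term t x G)))
      ≡⟨ ∑-cong X (λ x → sym (∑-*ˡ L (ι (x <ᵇ i)) (λ G → ι (F ⊆ᵇ G) *ᶻ (term i x G -ᶻ term t x G)))) ⟩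
    (∑[ x ∈ X ] ∑[ G ∈ L ] ι (x <ᵇ i) *ᶻ (ι (F ⊆ᵇ G) *ᶻ (term i x G -ᶻ term t x G)))
      ≡⟨ ∑-swap X L (λ x G → ι (x <ᵇ i) *ᶻ (ι (F ⊆ᵇ G) *ᶻ (term i x G -ᶻ term t x G))) ⟩
    (∑[ G ∈ L ] ∑[ x ∈ X ] ι (x <ᵇ i) *ᶻ (ι (F ⊆ᵇ G) *ᶻ (term i x G -ᶻ term t x G)))
      ≡⟨ ∑-cong L (λ G → trans (∑-cong X (λ x → distrib (ι (x <ᵇ i)) (ι (F ⊆ᵇ G)) (term i x G) (term t x G)))
           (trans (∑-*ˡ X (ι (F ⊆ᵇ G)) (λ x → ι (x <ᵇ i) *ᶻ term i x G -ᶻ ι (x <ᵇ i) *ᶻ term t x G))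
           (trans (cong (ι (F ⊆ᵇ G) *ᶻ_) (∑-- X (λ x → ι (x <ᵇ i) *ᶻ term i x G) (λ x → ι (x <ᵇ i) *ᶻ term t x G)))
                  (distribˡ (ι (F ⊆ᵇ G)) (pick (crk M G) i i (f G)) (pick (crk M G) t i (f G)))))) ⟩
    (∑[ G ∈ L ] (ι (F ⊆ᵇ G) *ᶻ pick (crk M G) i i (f G) -ᶻ ι (F ⊆ᵇ G) *ᶻ pick (crk M G) t i (f G)))
      ≡⟨ ∑-- L (λ G → ι (F ⊆ᵇ G) *ᶻ pick (crk M G) i i (f G)) (λ G → ι (F ⊆ᵇ G) *ᶻ pick (crk M G) t i (f G)) ⟩
    (∑[ G ∈ L ] ι (F ⊆ᵇ G) *ᶻ pick (crk M G) i i (f G)) -ᶻ (∑[ G ∈ L ] ι (F ⊆ᵇ G) *ᶻ pick (crk M G) t i (f G)) ∎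
    where
    open ≡-Reasoning
    term : ℕ → ℕ → Subset n → ℤ
    term j x G = ι (crk M G ≡ᵇ j + x) *ᶻ f G x
    distrib : ∀ a b p q → a *ᶻ (b *ᶻ (p -ᶻ q)) ≡ b *ᶻ (a *ᶻ p -ᶻ a *ᶻ q)
    distrib = solve-∀
    distribˡ : ∀ a p q → a *ᶻ (p -ᶻ q) ≡ a *ᶻ p -ᶻ a *ᶻ q
    distribˡ = solve-∀

  crk-+ : ∀ {F H} → (F ⊆ᵇ H) ≡ true → crk M H + (rk M H ∸ rk M F) ≡ crk M F
  crk-+ {F} {H} F⊆H = trans (sym (ℕP.+-∸-assoc (crk M H) (rk-mono M (⊆ᵇ-true⁻ {X = F} {H} F⊆H))))
    (cong (_∸ rk M F) (ℕP.m∸n+n≡m (rk-≤-rkM M H)))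

  crk-0⇒⊤ : ∀ {H} → Flat M H → crk M H ≡ 0 → H ≡ ⊤
  crk-0⇒⊤ {H} fH e = rk-strict M fH (⊆ᵇ-⊤ H) (ℕP.m∸n≡0⇒m≤n e)

  -- From palindromicity to the recursion

  module _ (P : Subset n → Subset n → ℕ → ℤ) (kl : IsKL M P) where

    private
      C : Subset n → ℕ → ℤ
      C = c M P kl

    C-vanish : ∀ {F k} → Flat M F → 0 < crk M F → crk M F ≤ k + k → C F k ≡ 0ℤ
    C-vanish {F} {k} fF pos = proj₁ (proj₂ (kl F ⊤ fF (⊤-flat M) (⊆ᵇ-⊤ F))) pos k

    C-⊤ : ∀ k → C ⊤ k ≡ polyOne k
    C-⊤ = proj₁ (kl ⊤ ⊤ (⊤-flat M) (⊤-flat M) (⊆ᵇ-⊤ (⊤ {n}))) (ℕP.n∸n≡0 (rk M ⊤))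

    -- For `H = F` the summand is the wanted coefficient, and `pick` misses because it would need
    -- `x = i`. For a rank gap d > 0 the coefficient read is the one at x = i - d, and crk H = i + t
    -- - d = t + x; if d > i, both sides vanish. So here `x < i` comes from `H` being strictly above
    -- `F`.
    shift-split : ∀ {F H t i} → Flat M F → (F ⊆ᵇ H) ≡ true → i < t → crk M F ≡ i + t →
      shift M P kl F H i ≡ ι (H ≟ˢ F) *ᶻ C H i +ᶻ pick (crk M H) t i (C H)
    shift-split {F} {H} {t} {i} fF F⊆H i<t e = by-rank-gap (rk M H ∸ rk M F) refl
      where
      i≤R : i ≤ rkM M
      i≤R = ℕP.≤-trans (ℕP.≤-trans (ℕP.m≤m+n i t) (ℕP.≤-reflexive (sym e))) (ℕP.m∸n≤m (rkM M) (rk M F))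
      gap : ∀ d → rk M H ∸ rk M F ≡ d → crk M H + d ≡ i + t
      gap d refl = trans (crk-+ {F} {H} F⊆H) e
      by-rank-gap : ∀ d → rk M H ∸ rk M F ≡ d → shift M P kl F H i ≡ ι (H ≟ˢ F) *ᶻ C H i +ᶻ pick (crk M H) t i (C H)
      by-rank-gap zero d≡ with refl ← rk-strict M fF F⊆H (ℕP.m∸n≡0⇒m≤n d≡) = begin
        shift M P kl F F i                 ≡⟨ cong (λ d → ι (d <ᵇ suc i) *ᶻ C F (i ∸ d)) d≡ ⟩
        1ℤ *ᶻ C F i                        ≡⟨ ℤP.*-identityˡ (C F i) ⟩
        C F i                              ≡⟨ ι-true (C F i) (≟ˢ-refl F) ⟨
        ι (F ≟ˢ F) *ᶻ C F i                ≡⟨ ℤP.+-identityʳ (ι (F ≟ˢ F) *ᶻ C F i) ⟨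
        ι (F ≟ˢ F) *ᶻ C F i +ᶻ 0ℤ          ≡⟨ cong (ι (F ≟ˢ F) *ᶻ C F i +ᶻ_) (pick-miss (crk M F) t i (C F) (λ x x<i h →
          ℕP.<⇒≢ x<i (ℕP.+-cancelˡ-≡ t x i (trans (sym h) (trans e (ℕP.+-comm i t)))))) ⟨
        ι (F ≟ˢ F) *ᶻ C F i +ᶻ pick (crk M F) t i (C F) ∎
        where open ≡-Reasoning
      by-rank-gap (suc d) d≡ = trans (other (suc d ≤? i)) (sym (trans (cong (_+ᶻ pick (crk M H) t i (C H)) (ι-false (C H i) H≢F))
          (ℤP.+-identityˡ (pick (crk M H) t i (C H)))))
        where
        H≢F : ¬ (H ≟ˢ F) ≡ true
        H≢F h with refl ← ≟ˢ-true⁻ {X = H} {F} h with () ← trans (sym (ℕP.n∸n≡0 (rk M F))) d≡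
        other : Dec (suc d ≤ i) → shift M P kl F H i ≡ pick (crk M H) t i (C H)
        other (yes d<i) = trans (cong (λ d → ι (d <ᵇ suc i) *ᶻ C H (i ∸ d)) d≡)
          (trans (ι-true (C H (i ∸ suc d)) (<ᵇ-true⁺ (s≤s d<i)))
            (sym (pick-hit t i (C H) (ℕP.∸-monoʳ-< {i} (s≤s z≤n) d<i) i≤R
              (ℕP.+-cancelʳ-≡ (suc d) (crk M H) (t + (i ∸ suc d)) (trans (gap (suc d) d≡)
                (trans (ℕP.+-comm i t) (sym (trans (ℕP.+-assoc t (i ∸ suc d) (suc d)) (cong (t +_) (ℕP.m∸n+n≡m d<i))))))))))
        other (no d≮i) = trans (cong (λ d → ι (d <ᵇ suc i) *ᶻ C H (i ∸ d)) d≡)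
          (trans (ι-false (C H (i ∸ suc d)) (λ h → d≮i (ℕP.≤-pred (<ᵇ-true⁻ {suc d} {suc i} h))))
            (sym (pick-miss (crk M H) t i (C H) (λ x x<i h → d≮i (ℕP.≤-trans (ℕP.m≤n+m (suc d) x) (ℕP.≤-reflexive
              (ℕP.+-cancelˡ-≡ t (x + suc d) i (trans (sym (ℕP.+-assoc t x (suc d)))
                (trans (cong (_+ suc d) (sym h)) (trans (gap (suc d) d≡) (ℕP.+-comm i t)))))))))))

    -- Here `x < i` comes from the degree bound: with x = crk H - i, the condition 2x < crk H says
    -- exactly x < i. The bound does not cover rank zero, and `H = ⊤` accounts for the extra
    -- constant term.
    rev-split : ∀ {H i} → Flat M H → i ≤ rkM M →
      rev M P kl H i ≡ ι (H ≟ˢ ⊤) *ᶻ ι (i ≡ᵇ 0) +ᶻ pick (crk M H) i i (C H)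
    rev-split {H} {i} fH i≤R with true-or-false (i ≤ᵇ crk M H)
    ... | inj₂ i≰ = trans (cong (λ b → if b then C H (crk M H ∸ i) else 0ℤ) i≰) (sym (cong₂ _+ᶻ_
          (trans (ℤP.*-comm (ι (H ≟ˢ ⊤)) (ι (i ≡ᵇ 0))) (ι-false (ι (H ≟ˢ ⊤)) (λ h → false≢true i≰
            (≤ᵇ-true⁺ (subst (_≤ crk M H) (sym (≡ᵇ-true⁻ {i} {0} h)) z≤n)))))
          (pick-miss (crk M H) i i (C H) (λ x _ h → false≢true i≰ (≤ᵇ-true⁺ (ℕP.≤-trans (ℕP.m≤m+n i x) (ℕP.≤-reflexive (sym h))))))))
    ... | inj₁ i≤ = trans (cong (λ b → if b then C H (crk M H ∸ i) else 0ℤ) i≤) (by-size (suc y ≤? i))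
      where
      y : ℕ
      y = crk M H ∸ i
      crk≡ : crk M H ≡ i + y
      crk≡ = sym (ℕP.m+[n∸m]≡n (≤ᵇ-true⁻ {i} {crk M H} i≤))
      miss : ¬ y < i → pick (crk M H) i i (C H) ≡ 0ℤ
      miss y≮i = pick-miss (crk M H) i i (C H) (λ x x<i h → y≮i (subst (_< i) (ℕP.+-cancelˡ-≡ i x y (trans (sym h) crk≡)) x<i))
      by-size : Dec (suc y ≤ i) → C H y ≡ ι (H ≟ˢ ⊤) *ᶻ ι (i ≡ᵇ 0) +ᶻ pick (crk M H) i i (C H)
      by-size (yes y<i) = sym (trans (cong₂ _+ᶻ_
          (trans (ℤP.*-comm (ι (H ≟ˢ ⊤)) (ι (i ≡ᵇ 0))) (ι-false (ι (H ≟ˢ ⊤)) (λ h → ℕP.<⇒≢ (ℕP.≤-<-trans z≤n y<i) (sym (≡ᵇ-true⁻ {i} {0} h)))))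
          (pick-hit i i (C H) y<i i≤R crk≡)) (ℤP.+-identityˡ (C H y)))
      by-size (no y≮i) = trans (by-crk (crk M H) refl) (sym (trans (cong (ι (H ≟ˢ ⊤) *ᶻ ι (i ≡ᵇ 0) +ᶻ_) (miss y≮i)) (ℤP.+-identityʳ _)))
        where
        -- Now `i ≤ y`, hence `crk M H ≤ y + y`, and the coefficient vanishes unless the corank is
        -- zero; in that case `H` is `⊤` and `i` and `y` are both zero.
        by-crk : ∀ m → crk M H ≡ m → C H y ≡ ι (H ≟ˢ ⊤) *ᶻ ι (i ≡ᵇ 0)
        by-crk zero m≡ with refl ← crk-0⇒⊤ fH m≡ = begin
          C ⊤ y                              ≡⟨ C-⊤ y ⟩
          polyOne y                          ≡⟨ cong polyOne y≡0 ⟩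
          1ℤ                                 ≡⟨ cong (λ j → ι (j ≡ᵇ 0)) i≡0 ⟨
          ι (i ≡ᵇ 0)                         ≡⟨ ι-true (ι (i ≡ᵇ 0)) (≟ˢ-refl (⊤ {n})) ⟨
          ι (⊤ {n} ≟ˢ ⊤) *ᶻ ι (i ≡ᵇ 0)       ∎
          where
          open ≡-Reasoning
          i+y≡0 : i + y ≡ 0
          i+y≡0 = trans (sym crk≡) m≡
          i≡0 : i ≡ 0
          i≡0 = ℕP.m+n≡0⇒m≡0 i i+y≡0
          y≡0 : y ≡ 0
          y≡0 = ℕP.m+n≡0⇒n≡0 i i+y≡0
        by-crk (suc m) m≡ = trans
          (C-vanish fH (subst (0 <_) (sym m≡) (s≤s z≤n)) (ℕP.≤-trans (ℕP.≤-reflexive crk≡) (ℕP.+-monoˡ-≤ y (ℕP.≮⇒≥ y≮i))))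
          (sym (ι-false (ι (i ≡ᵇ 0)) H≢⊤))
          where
          H≢⊤ : ¬ (H ≟ˢ ⊤) ≡ true
          H≢⊤ h with refl ← ≟ˢ-true⁻ {X = H} {⊤} h with () ← trans (sym (ℕP.n∸n≡0 (rk M ⊤))) m≡

    C-rec : ∀ {F t i} → Flat M F → i < t → crk M F ≡ i + t →
      C F i ≡ ι (i ≡ᵇ 0) +ᶻ step (λ G _ x → C G x) F t i
    C-rec {F} {t} {i} fF i<t e = trans (solve-for (C F i) (ι (i ≡ᵇ 0)) A B (begin
      C F i +ᶻ A                                                        ≡⟨ Z≡ ⟨
      Z M P kl F i                                                      ≡⟨ Z-palindromic M P kl F fF i ⟩
      Zrev M P kl F i                                                   ≡⟨ Zrev≡ ⟩
      ι (i ≡ᵇ 0) +ᶻ B                                                   ∎))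
      (cong (ι (i ≡ᵇ 0) +ᶻ_) (sym (step-pick C F t i)))
      where
      open ≡-Reasoning
      A B : ℤ
      A = ∑[ G ∈ L ] ι (F ⊆ᵇ G) *ᶻ pick (crk M G) t i (C G)
      B = ∑[ G ∈ L ] ι (F ⊆ᵇ G) *ᶻ pick (crk M G) i i (C G)
      solve-for : ∀ p q a b → p +ᶻ a ≡ q +ᶻ b → p ≡ q +ᶻ (b -ᶻ a)
      solve-for p q a b h = trans (cancel p a) (trans (cong (_-ᶻ a) h) (ℤP.+-assoc q b (-ᶻ a)))
        where
        cancel : ∀ p a → p ≡ p +ᶻ a -ᶻ a
        cancel = solve-∀
      i≤R : i ≤ rkM M
      i≤R = ℕP.≤-trans (ℕP.≤-trans (ℕP.m≤m+n i t) (ℕP.≤-reflexive (sym e))) (ℕP.m∸n≤m (rkM M) (rk M F))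
      distrib : ∀ a b x y → a *ᶻ (b *ᶻ x +ᶻ y) ≡ b *ᶻ (a *ᶻ x) +ᶻ a *ᶻ y
      distrib = solve-∀
      isolate : ∀ {K} → Flat M K → (F ⊆ᵇ K) ≡ true → ∀ (f : Subset n → ℤ) (g : Subset n → ℤ) →
        (∑[ H ∈ L ] ι (F ⊆ᵇ H) *ᶻ (ι (H ≟ˢ K) *ᶻ f H +ᶻ g H)) ≡ f K +ᶻ (∑[ H ∈ L ] ι (F ⊆ᵇ H) *ᶻ g H)
      isolate {K} fK F⊆K f g = begin
        (∑[ H ∈ L ] ι (F ⊆ᵇ H) *ᶻ (ι (H ≟ˢ K) *ᶻ f H +ᶻ g H))
          ≡⟨ ∑-cong L (λ H → distrib (ι (F ⊆ᵇ H)) (ι (H ≟ˢ K)) (f H) (g H)) ⟩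
        (∑[ H ∈ L ] (ι (H ≟ˢ K) *ᶻ (ι (F ⊆ᵇ H) *ᶻ f H) +ᶻ ι (F ⊆ᵇ H) *ᶻ g H))
          ≡⟨ ∑-+ L (λ H → ι (H ≟ˢ K) *ᶻ (ι (F ⊆ᵇ H) *ᶻ f H)) (λ H → ι (F ⊆ᵇ H) *ᶻ g H) ⟩
        (∑[ H ∈ L ] ι (H ≟ˢ K) *ᶻ (ι (F ⊆ᵇ H) *ᶻ f H)) +ᶻ (∑[ H ∈ L ] ι (F ⊆ᵇ H) *ᶻ g H)
          ≡⟨ cong (_+ᶻ (∑[ H ∈ L ] ι (F ⊆ᵇ H) *ᶻ g H)) (trans (∑-flats-δ M fK (λ H → ι (F ⊆ᵇ H) *ᶻ f H)) (ι-true (f K) F⊆K)) ⟩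
        f K +ᶻ (∑[ H ∈ L ] ι (F ⊆ᵇ H) *ᶻ g H) ∎
      Z≡ : Z M P kl F i ≡ C F i +ᶻ A
      Z≡ = trans (∑-cong L (λ H → ι-cong (λ F⊆H → shift-split {F} {H} fF F⊆H i<t e)))
        (isolate fF (⊆ᵇ-refl F) (λ H → C H i) (λ H → pick (crk M H) t i (C H)))
      Zrev≡ : Zrev M P kl F i ≡ ι (i ≡ᵇ 0) +ᶻ B
      Zrev≡ = trans (∑-flats-cong M (λ H fH → cong (ι (F ⊆ᵇ H) *ᶻ_) (rev-split fH i≤R)))
        (isolate (⊤-flat M) (⊆ᵇ-⊤ F) (λ _ → ι (i ≡ᵇ 0)) (λ H → pick (crk M H) i i (C H)))

    -- The induction is on a bound `b` instead of `i`, so that all recursive calls, at various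
    -- `x < i`, share one range of depths. Enlarging the range is harmless: `E r` is zero once `r`
    -- exceeds `i`, as no strictly decreasing chain of indices is that long.
    ∑E≡C : ∀ b {F t i} → Flat M F → i ≤ b → i < t → crk M F ≡ i + t → (∑[ r ∈ upTo (suc b) ] E r F t i) ≡ C F i
    ∑E≡C zero    {F} {t} {zero} fF i≤b i<t e = sym (trans (C-rec fF i<t e) (cong (1ℤ +ᶻ_) (step-at-0 (λ G _ x → C G x) F t)))
    ∑E≡C (suc b) {F} {t} {i} fF i≤b i<t e = begin
      (∑[ r ∈ upTo (suc (suc b)) ] E r F t i)                               ≡⟨ ∑-upTo-suc (suc b) (λ r → E r F t i) ⟩
      ι (i ≡ᵇ 0) +ᶻ (∑[ r ∈ upTo (suc b) ] step (E r) F t i)                ≡⟨ cong (ι (i ≡ᵇ 0) +ᶻ_) (step-∑ (upTo (suc b)) E F t i) ⟩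
      ι (i ≡ᵇ 0) +ᶻ step (λ G u x → ∑[ r ∈ upTo (suc b) ] E r G u x) F t i  ≡⟨ cong (ι (i ≡ᵇ 0) +ᶻ_) (step-cong {F = F}
        (λ G x fG x<i h → ∑E≡C b fG (ℕP.≤-pred (ℕP.≤-trans x<i i≤b)) x<i (trans h (ℕP.+-comm i x)))
        (λ G x fG x<i h → ∑E≡C b fG (ℕP.≤-pred (ℕP.≤-trans x<i i≤b)) (ℕP.<-trans x<i i<t) (trans h (ℕP.+-comm t x)))) ⟩
      ι (i ≡ᵇ 0) +ᶻ step (λ G _ x → C G x) F t i                            ≡⟨ C-rec fF i<t e ⟨
      C F i                                                                 ∎
      where open ≡-Reasoning

-- Whitney numbers and the summation over index sequences

∑-allSubsets-∷ : ∀ r (f : Subset (suc r) → ℤ) →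
  ∑ (allSubsets (suc r)) f ≡ (∑[ S ∈ allSubsets r ] f (true ∷ S)) +ᶻ (∑[ S ∈ allSubsets r ] f (false ∷ S))
∑-allSubsets-∷ r f = trans (∑-++ (map (true ∷_) (allSubsets r)) (map (false ∷_) (allSubsets r)) f)
  (cong₂ _+ᶻ_ (∑-map (true ∷_) (allSubsets r) f) (∑-map (false ∷_) (allSubsets r) f))

-- Regrouping by the last membership instead of the first, since the recursion removes the largest
-- element of [r + 1].
∑-allSubsets-∷ʳ : ∀ r (f : Subset (suc r) → ℤ) →
  ∑ (allSubsets (suc r)) f ≡ (∑[ S ∈ allSubsets r ] (f (S ∷ʳ true) +ᶻ f (S ∷ʳ false)))
∑-allSubsets-∷ʳ zero    f = sym (ℤP.+-assoc (f (true ∷ [])) (f (false ∷ [])) 0ℤ)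
∑-allSubsets-∷ʳ (suc r) f = trans (∑-allSubsets-∷ (suc r) f)
  (trans (cong₂ _+ᶻ_ (∑-allSubsets-∷ʳ r (f ∘ (true ∷_))) (∑-allSubsets-∷ʳ r (f ∘ (false ∷_))))
    (sym (∑-allSubsets-∷ r (λ S → f (S ∷ʳ true) +ᶻ f (S ∷ʳ false)))))

∑-vecs-∷ : ∀ l b (f : List ℕ → ℤ) → ∑ (vecs (suc l) b) f ≡ (∑[ x ∈ upTo (suc b) ] ∑[ a ∈ vecs l b ] f (x ∷ a))
∑-vecs-∷ l b f = trans (∑-concatMap (λ x → map (x ∷_) (vecs l b)) (upTo (suc b)) f)
  (∑-cong (upTo (suc b)) (λ x → ∑-map (x ∷_) (vecs l b) f))

∑-vecs-∷ʳ : ∀ l b (f : List ℕ → ℤ) → ∑ (vecs (suc l) b) f ≡ (∑[ a ∈ vecs l b ] ∑[ x ∈ upTo (suc b) ] f (a ++ [ x ]))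
∑-vecs-∷ʳ zero    b f = trans (∑-vecs-∷ 0 b f) (trans (∑-cong (upTo (suc b)) (λ x → ℤP.+-identityʳ (f [ x ])))
  (sym (ℤP.+-identityʳ (∑[ x ∈ upTo (suc b) ] f [ x ]))))
∑-vecs-∷ʳ (suc l) b f = trans (∑-vecs-∷ (suc l) b f)
  (trans (∑-cong (upTo (suc b)) (λ y → ∑-vecs-∷ʳ l b (f ∘ (y ∷_))))
    (sym (∑-vecs-∷ l b (λ a → ∑[ x ∈ upTo (suc b) ] f (a ++ [ x ])))))

∑-vecs-cong : ∀ l b {f g : List ℕ → ℤ} → (∀ a → length a ≡ l → f a ≡ g a) → ∑ (vecs l b) f ≡ ∑ (vecs l b) g
∑-vecs-cong zero    b h = cong (_+ᶻ 0ℤ) (h [] refl)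
∑-vecs-cong (suc l) b {f} {g} h = trans (∑-vecs-∷ l b f)
  (trans (∑-cong (upTo (suc b)) (λ x → ∑-vecs-cong l b (λ a e → h (x ∷ a) (cong suc e)))) (sym (∑-vecs-∷ l b g)))

nth-++ : ∀ a l m {r} → length a ≡ r → nth (a ++ l) (r + m) ≡ nth l m
nth-++ []      l m refl = refl
nth-++ (x ∷ a) l m refl = nth-++ a l m refl

nth-++-∷ : ∀ a x l l′ k → k ≤ length a → nth (a ++ x ∷ l) k ≡ nth (a ++ x ∷ l′) k
nth-++-∷ []      x l l′ zero    _       = refl
nth-++-∷ (y ∷ a) x l l′ zero    _       = refl
nth-++-∷ (y ∷ a) x l l′ (suc k) (s≤s h) = nth-++-∷ a x l l′ k h

strictlyIncr-∷ʳ : ∀ a x y → strictlyIncr (a ++ x ∷ y ∷ []) ≡ strictlyIncr (a ++ [ x ]) ∧ (x <ᵇ y)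
strictlyIncr-∷ʳ []          x y = ∧-identityʳ (x <ᵇ y)
strictlyIncr-∷ʳ (z ∷ [])    x y = trans (cong ((z <ᵇ x) ∧_) (∧-identityʳ (x <ᵇ y))) (cong (_∧ (x <ᵇ y)) (sym (∧-identityʳ (z <ᵇ x))))
strictlyIncr-∷ʳ (z ∷ w ∷ a) x y = trans (cong ((z <ᵇ w) ∧_) (strictlyIncr-∷ʳ (w ∷ a) x y))
  (sym (∧-assoc (z <ᵇ w) (strictlyIncr (w ∷ a ++ [ x ])) (x <ᵇ y)))

-- The indices t_j(S) when S is extended by one position

memb-∷ʳ-last : ∀ {r} (S : Subset r) s → memb (toList (S ∷ʳ s)) (suc r) ≡ s
memb-∷ʳ-last []      s = refl
memb-∷ʳ-last (b ∷ S) s = memb-∷ʳ-last S s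

memb-∷ʳ-init : ∀ {r} (S : Subset r) s k → k < r → memb (toList (S ∷ʳ s)) (suc k) ≡ memb (toList S) (suc k)
memb-∷ʳ-init (b ∷ S) s zero    _       = refl
memb-∷ʳ-init (b ∷ S) s (suc k) (s≤s h) = memb-∷ʳ-init S s k h

∣∷ʳtrue∣ : ∀ {r} (S : Subset r) → ∣ S ∷ʳ true ∣ ≡ suc ∣ S ∣
∣∷ʳtrue∣ []          = refl
∣∷ʳtrue∣ (true  ∷ S) = cong suc (∣∷ʳtrue∣ S)
∣∷ʳtrue∣ (false ∷ S) = ∣∷ʳtrue∣ S

∣∷ʳfalse∣ : ∀ {r} (S : Subset r) → ∣ S ∷ʳ false ∣ ≡ ∣ S ∣
∣∷ʳfalse∣ []          = refl
∣∷ʳfalse∣ (true  ∷ S) = cong suc (∣∷ʳfalse∣ S)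
∣∷ʳfalse∣ (false ∷ S) = ∣∷ʳfalse∣ S

-- scan is the function local to tIdx, which has no name outside; unification finds it from one unfolding of tIdx.
mutual
  scan : (r : ℕ) (S : Subset r) (j f k : ℕ) → ℕ
  scan = _

  tIdx-unfold : ∀ r (S : Subset r) j f → suc r ∸ j ≡ suc f → memb (toList S) j ≡ true → tIdx r S j ≡ scan r S j f (suc j)
  tIdx-unfold r S j f e m with suc r ∸ j
  tIdx-unfold r S j f refl m | suc f with memb (toList S) j
  tIdx-unfold r S j f refl refl | suc f | true with suc j
  ... | k = refl

-- The two searches agree while they stay inside [r], and if they stop there, the entries read agree
-- as well. If they run through, the shorter one stops at r + 1, while the longer one stops at r + 1
-- (entry `y`) or r + 2 (entry `z`) according to `s`; the shorter sequence was given that very entry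
-- in position r + 1. The equation on `f` says that the fuel of the shorter search ends exactly at r
-- + 1.
scan-∷ʳ : ∀ {r} (S : Subset r) s a x y z j f k → length a ≡ r → f + suc k ≡ suc r →
  nth (a ++ x ∷ y ∷ z ∷ []) (scan (suc r) (S ∷ʳ s) j (suc f) (suc k)) ≡
  nth (a ++ x ∷ (if s then z else y) ∷ []) (scan r S j f (suc k))
scan-∷ʳ {r} S s a x y z j zero k len refl rewrite memb-∷ʳ-last S s = at-end s
  where
  shift-index : ∀ l m → nth (a ++ l) (m + r) ≡ nth l m
  shift-index l m = trans (cong (nth (a ++ l)) (ℕP.+-comm m r)) (nth-++ a l m len)
  at-end : ∀ s → nth (a ++ x ∷ y ∷ z ∷ []) (if s then suc (suc r) else suc r) ≡ nth (a ++ x ∷ (if s then z else y) ∷ []) (suc r)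
  at-end true  = trans (shift-index (x ∷ y ∷ z ∷ []) 2) (sym (shift-index (x ∷ z ∷ []) 1))
  at-end false = trans (shift-index (x ∷ y ∷ z ∷ []) 1) (sym (shift-index (x ∷ y ∷ []) 1))
scan-∷ʳ {r} S s a x y z j (suc f) k len e
  rewrite memb-∷ʳ-init S s k (ℕP.≤-trans (ℕP.m≤n+m (suc k) f) (ℕP.≤-reflexive (ℕP.suc-injective e)))
  with memb (toList S) (suc k)
... | true  = scan-∷ʳ S s a x y z j f (suc k) len (trans (ℕP.+-suc f (suc k)) e)
... | false = nth-++-∷ a x (y ∷ z ∷ []) ((if s then z else y) ∷ []) (suc k)
    (ℕP.≤-trans (ℕP.m≤n+m (suc k) f) (ℕP.≤-reflexive (trans (ℕP.suc-injective e) (sym len))))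

tIdx-∷ʳ : ∀ {r} (S : Subset r) s a x y z j → length a ≡ r → j ≤ r →
  nth (a ++ x ∷ y ∷ z ∷ []) (tIdx (suc r) (S ∷ʳ s) (suc j)) ≡
  nth (a ++ x ∷ (if s then z else y) ∷ []) (tIdx r S (suc j))
tIdx-∷ʳ {r} S s a x y z j len j≤r = trans
  (cong (λ f → nth (a ++ x ∷ y ∷ z ∷ []) (scan (suc r) (S ∷ʳ s) (suc j) f (suc j))) (ℕP.+-∸-assoc 1 j≤r))
  (scan-∷ʳ S s a x y z (suc j) (r ∸ j) j len (trans (ℕP.+-suc (r ∸ j) j) (cong suc (ℕP.m∸n+n≡m j≤r))))

-- The boundary index r + 1 arises when the topmost index of the longer sequence is expressed
-- through the shorter one.
tIdx-last : ∀ {r} (S : Subset r) a x u → length a ≡ r → nth (a ++ x ∷ u ∷ []) (tIdx r S (suc r)) ≡ u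
tIdx-last {r} S a x u len = trans (cong (λ f → nth (a ++ x ∷ u ∷ []) (scan r S (suc r) f (suc r))) (ℕP.n∸n≡0 r))
  (trans (cong (nth (a ++ x ∷ u ∷ [])) (ℕP.+-comm 1 r)) (nth-++ a (x ∷ u ∷ []) 1 len))

map-downFrom-cong : ∀ {A : Set} r {f g : ℕ → A} → (∀ j → j < r → f (suc j) ≡ g (suc j)) →
  map f (map suc (downFrom r)) ≡ map g (map suc (downFrom r))
map-downFrom-cong zero    h = refl
map-downFrom-cong (suc r) h = cong₂ _∷_ (h r ℕP.≤-refl) (map-downFrom-cong r (λ j j<r → h j (ℕP.m<n⇒m<1+n j<r)))

-- Whether r + 1 ∈ S only decides which of a_{r+1}, a_{r+2} plays the role of the last entry for S ∩ [r].
whitneyArgs-∷ʳ : ∀ {r} (S : Subset r) s a x y z → length a ≡ r →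
  whitneyArgs (suc r) (S ∷ʳ s) (a ++ x ∷ y ∷ z ∷ []) ≡
  ((if s then z else y) + x) ∷ whitneyArgs r S (a ++ x ∷ (if s then z else y) ∷ [])
whitneyArgs-∷ʳ {r} S s a x y z len = cong₂ _∷_
  (cong₂ _+_ (trans (tIdx-∷ʳ S s a x y z r len ℕP.≤-refl) (tIdx-last S a x (if s then z else y) len))
    (trans (cong (nth (a ++ x ∷ y ∷ z ∷ [])) (sym (ℕP.+-identityʳ r))) (nth-++ a (x ∷ y ∷ z ∷ []) 0 len)))
  (map-downFrom-cong r (λ j j<r → cong₂ _+_
    (tIdx-∷ʳ S s a x y z j len (ℕP.<⇒≤ j<r))
    (nth-++-∷ a x (y ∷ z ∷ []) ((if s then z else y) ∷ []) j (ℕP.≤-trans (ℕP.<⇒≤ j<r) (ℕP.≤-reflexive (sym len))))))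

-- Whitney numbers as counts of chains above a flat

module _ {n : ℕ} (M : Matroid n) where

  private
    L : List (Subset n)
    L = flats M
    X : List ℕ
    X = upTo (suc (rkM M))

  -- The lower bound `F` turns the Whitney number into a recursion on the smallest flat of the
  -- chain, parallel to that of `step`.
  chains : Subset n → List ℕ → ℤ
  chains F []       = 1ℤ
  chains F (i ∷ is) = ∑[ G ∈ L ] ι (F ⊆ᵇ G) *ᶻ (ι (crk M G ≡ᵇ i) *ᶻ chains G is)

  ∑-tuples : ∀ F is → (∑[ Fs ∈ tuples M (length is) ] ι (isChain M (F ∷ Fs) ∧ crksMatch M Fs is)) ≡ chains F is
  ∑-tuples F []       = refl
  ∑-tuples F (i ∷ is) = begin
    (∑[ Fs ∈ tuples M (suc (length is)) ] ι (isChain M (F ∷ Fs) ∧ crksMatch M Fs (i ∷ is)))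
      ≡⟨ ∑-concatMap (λ G → map (G ∷_) Ts) L (λ Fs → ι (isChain M (F ∷ Fs) ∧ crksMatch M Fs (i ∷ is))) ⟩
    (∑[ G ∈ L ] ∑ (map (G ∷_) Ts) (λ Fs → ι (isChain M (F ∷ Fs) ∧ crksMatch M Fs (i ∷ is))))
      ≡⟨ ∑-cong L (λ G → ∑-map (G ∷_) Ts (λ Fs → ι (isChain M (F ∷ Fs) ∧ crksMatch M Fs (i ∷ is)))) ⟩
    (∑[ G ∈ L ] ∑[ Fs ∈ Ts ] ι (((F ⊆ᵇ G) ∧ isChain M (G ∷ Fs)) ∧ ((crk M G ≡ᵇ i) ∧ crksMatch M Fs is)))
      ≡⟨ ∑-cong L (λ G → ∑-cong Ts (λ Fs → separate (F ⊆ᵇ G) (isChain M (G ∷ Fs)) (crk M G ≡ᵇ i) (crksMatch M Fs is))) ⟩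
    (∑[ G ∈ L ] ∑[ Fs ∈ Ts ] ι (F ⊆ᵇ G) *ᶻ (ι (crk M G ≡ᵇ i) *ᶻ ι (isChain M (G ∷ Fs) ∧ crksMatch M Fs is)))
      ≡⟨ ∑-cong L (λ G → trans
           (∑-*ˡ Ts (ι (F ⊆ᵇ G)) (λ Fs → ι (crk M G ≡ᵇ i) *ᶻ ι (isChain M (G ∷ Fs) ∧ crksMatch M Fs is)))
           (cong (ι (F ⊆ᵇ G) *ᶻ_) (trans (∑-*ˡ Ts (ι (crk M G ≡ᵇ i)) (λ Fs → ι (isChain M (G ∷ Fs) ∧ crksMatch M Fs is)))
             (cong (ι (crk M G ≡ᵇ i) *ᶻ_) (∑-tuples G is))))) ⟩
    chains F (i ∷ is) ∎
    where
    open ≡-Reasoning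
    Ts : List (List (Subset n))
    Ts = tuples M (length is)
    separate : ∀ p q r s → ι ((p ∧ q) ∧ (r ∧ s)) ≡ ι p *ᶻ (ι r *ᶻ ι (q ∧ s))
    separate false q     r     s = sym (ℤP.*-zeroˡ (ι r *ᶻ ι (q ∧ s)))
    separate true  true  true  s = sym (trans (ℤP.*-identityˡ (1ℤ *ᶻ ι s)) (ℤP.*-identityˡ (ι s)))
    separate true  true  false s = sym (trans (ℤP.*-identityˡ (0ℤ *ᶻ ι s)) (ℤP.*-zeroˡ (ι s)))
    separate true  false true  s = refl
    separate true  false false s = refl

  -- Every flat contains `bottom M`, so placing it below a chain of flats imposes no new condition.
  whitney-chains : ∀ is → ℤ.+ whitney M is ≡ chains (bottom M) is
  whitney-chains is = trans (length-filterᵇ (λ Fs → isChain M Fs ∧ crksMatch M Fs is) (tuples M (length is)))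
    (trans (add-bottom is) (∑-tuples (bottom M) is))
    where
    open ≡-Reasoning
    add-bottom : ∀ is → (∑[ Fs ∈ tuples M (length is) ] ι (isChain M Fs ∧ crksMatch M Fs is)) ≡
      (∑[ Fs ∈ tuples M (length is) ] ι (isChain M (bottom M ∷ Fs) ∧ crksMatch M Fs is))
    add-bottom []       = refl
    add-bottom (i ∷ is) = begin
      ∑ (concatMap (λ G → map (G ∷_) Ts) L) f        ≡⟨ ∑-concatMap (λ G → map (G ∷_) Ts) L f ⟩
      (∑[ G ∈ L ] ∑ (map (G ∷_) Ts) f)               ≡⟨ ∑-flats-cong M (λ G fG → trans (∑-map (G ∷_) Ts f)
        (trans (∑-cong Ts (λ Fs → cong (λ b → ι ((b ∧ isChain M (G ∷ Fs)) ∧ crksMatch M (G ∷ Fs) (i ∷ is))) (sym (bottom-⊆ᵇ M fG))))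
          (sym (∑-map (G ∷_) Ts g)))) ⟩
      (∑[ G ∈ L ] ∑ (map (G ∷_) Ts) g)               ≡⟨ ∑-concatMap (λ G → map (G ∷_) Ts) L g ⟨
      ∑ (concatMap (λ G → map (G ∷_) Ts) L) g        ∎
      where
      Ts : List (List (Subset n))
      Ts = tuples M (length is)
      f g : List (Subset n) → ℤ
      f Fs = ι (isChain M Fs ∧ crksMatch M Fs (i ∷ is))
      g Fs = ι (isChain M (bottom M ∷ Fs) ∧ crksMatch M Fs (i ∷ is))

  -- Signed chain sums satisfy the same recursion

  admissible : List ℕ → Bool
  admissible a = strictlyIncr a ∧ (nth a 0 ≡ᵇ 0)

  admissible-∷ʳ : ∀ a x y → admissible (a ++ x ∷ y ∷ []) ≡ admissible (a ++ [ x ]) ∧ (x <ᵇ y)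
  admissible-∷ʳ a x y = begin
    strictlyIncr (a ++ x ∷ y ∷ []) ∧ (nth (a ++ x ∷ y ∷ []) 0 ≡ᵇ 0)
      ≡⟨ cong₂ _∧_ (strictlyIncr-∷ʳ a x y) (cong (_≡ᵇ 0) (nth-++-∷ a x [ y ] [] 0 z≤n)) ⟩
    (strictlyIncr (a ++ [ x ]) ∧ (x <ᵇ y)) ∧ (nth (a ++ [ x ]) 0 ≡ᵇ 0)
      ≡⟨ ∧-assoc (strictlyIncr (a ++ [ x ])) (x <ᵇ y) (nth (a ++ [ x ]) 0 ≡ᵇ 0) ⟩
    strictlyIncr (a ++ [ x ]) ∧ ((x <ᵇ y) ∧ (nth (a ++ [ x ]) 0 ≡ᵇ 0))
      ≡⟨ cong (strictlyIncr (a ++ [ x ]) ∧_) (∧-comm (x <ᵇ y) (nth (a ++ [ x ]) 0 ≡ᵇ 0)) ⟩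
    strictlyIncr (a ++ [ x ]) ∧ ((nth (a ++ [ x ]) 0 ≡ᵇ 0) ∧ (x <ᵇ y))
      ≡⟨ ∧-assoc (strictlyIncr (a ++ [ x ])) (nth (a ++ [ x ]) 0 ≡ᵇ 0) (x <ᵇ y) ⟨
    admissible (a ++ [ x ]) ∧ (x <ᵇ y) ∎
    where open ≡-Reasoning

  -- Here `a` lists a_0, ..., a_{r-1}, while `i` is a_r and `t` is a_{r+1}. The guard leaves out a_r
  -- < a_{r+1}, because `E` does not compare `i` with `t`; that inequality is dealt with separately
  -- when the sequences are summed.
  signedChains : ∀ r → Subset r → List ℕ → Subset n → ℕ → ℕ → ℤ
  signedChains r S a F t i = ι (admissible (a ++ [ i ])) *ᶻ (-1ℤ ^ ∣ S ∣ *ᶻ chains F (whitneyArgs r S (a ++ i ∷ t ∷ [])))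

  -- The two subsets with the same trace on [r] supply the two terms of `step`. They differ by a
  -- sign and by whether `t` or `i` is added to `x` in the first corank, and the same number becomes
  -- the last entry of the remaining sequence.
  signedChains-∷ʳ : ∀ {r} (S : Subset r) a → length a ≡ r → ∀ F t i x →
    signedChains (suc r) (S ∷ʳ true) (a ++ [ x ]) F t i +ᶻ signedChains (suc r) (S ∷ʳ false) (a ++ [ x ]) F t i ≡
    ι (x <ᵇ i) *ᶻ (∑[ G ∈ L ] ι (F ⊆ᵇ G) *ᶻ
      (ι (crk M G ≡ᵇ i + x) *ᶻ signedChains r S a G i x -ᶻ ι (crk M G ≡ᵇ t + x) *ᶻ signedChains r S a G t x))
  signedChains-∷ʳ {r} S a len F t i x = begin
    signedChains (suc r) (S ∷ʳ true) (a ++ [ x ]) F t i +ᶻ signedChains (suc r) (S ∷ʳ false) (a ++ [ x ]) F t i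
      ≡⟨ cong₂ _+ᶻ_ (expand true) (expand false) ⟩
    g *ᶻ p *ᶻ (-1ℤ ^ ∣ S ∷ʳ true ∣ *ᶻ W t) +ᶻ g *ᶻ p *ᶻ (-1ℤ ^ ∣ S ∷ʳ false ∣ *ᶻ W i)
      ≡⟨ cong₂ (λ u v → g *ᶻ p *ᶻ (-1ℤ ^ u *ᶻ W t) +ᶻ g *ᶻ p *ᶻ (-1ℤ ^ v *ᶻ W i)) (∣∷ʳtrue∣ S) (∣∷ʳfalse∣ S) ⟩
    g *ᶻ p *ᶻ (-1ℤ *ᶻ σ *ᶻ W t) +ᶻ g *ᶻ p *ᶻ (σ *ᶻ W i)
      ≡⟨ collect g p σ (W t) (W i) ⟩
    p *ᶻ (g *ᶻ σ *ᶻ W i -ᶻ g *ᶻ σ *ᶻ W t)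
      ≡⟨ cong (p *ᶻ_) (cong₂ _-ᶻ_ (∑-*ˡ L (g *ᶻ σ) (summand i)) (∑-*ˡ L (g *ᶻ σ) (summand t))) ⟨
    p *ᶻ ((∑[ G ∈ L ] g *ᶻ σ *ᶻ summand i G) -ᶻ (∑[ G ∈ L ] g *ᶻ σ *ᶻ summand t G))
      ≡⟨ cong (p *ᶻ_) (∑-- L (λ G → g *ᶻ σ *ᶻ summand i G) (λ G → g *ᶻ σ *ᶻ summand t G)) ⟨
    p *ᶻ (∑[ G ∈ L ] (g *ᶻ σ *ᶻ summand i G -ᶻ g *ᶻ σ *ᶻ summand t G))
      ≡⟨ cong (p *ᶻ_) (∑-cong L (λ G → distribute g σ (ι (F ⊆ᵇ G)) (ι (crk M G ≡ᵇ i + x)) (ι (crk M G ≡ᵇ t + x))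
           (chains G (args i)) (chains G (args t)))) ⟩
    p *ᶻ (∑[ G ∈ L ] ι (F ⊆ᵇ G) *ᶻ
      (ι (crk M G ≡ᵇ i + x) *ᶻ signedChains r S a G i x -ᶻ ι (crk M G ≡ᵇ t + x) *ᶻ signedChains r S a G t x)) ∎
    where
    open ≡-Reasoning
    g p σ : ℤ
    g = ι (admissible (a ++ [ x ]))
    p = ι (x <ᵇ i)
    σ = -1ℤ ^ ∣ S ∣
    args : ℕ → List ℕ
    args u = whitneyArgs r S (a ++ x ∷ u ∷ [])
    summand : ℕ → Subset n → ℤ
    summand u G = ι (F ⊆ᵇ G) *ᶻ (ι (crk M G ≡ᵇ u + x) *ᶻ chains G (args u))
    W : ℕ → ℤ
    W u = ∑[ G ∈ L ] summand u G
    expand : ∀ s → signedChains (suc r) (S ∷ʳ s) (a ++ [ x ]) F t i ≡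
      g *ᶻ p *ᶻ (-1ℤ ^ ∣ S ∷ʳ s ∣ *ᶻ W (if s then t else i))
    expand s = cong₂ _*ᶻ_
      (trans (cong (ι ∘ admissible) (++-assoc a [ x ] [ i ])) (trans (cong ι (admissible-∷ʳ a x i)) (ι-∧ (admissible (a ++ [ x ])) (x <ᵇ i))))
      (cong (λ is → -1ℤ ^ ∣ S ∷ʳ s ∣ *ᶻ chains F is)
        (trans (cong (whitneyArgs (suc r) (S ∷ʳ s)) (++-assoc a [ x ] (i ∷ t ∷ []))) (whitneyArgs-∷ʳ S s a x i t len)))
    collect : ∀ g p σ u v → g *ᶻ p *ᶻ (-1ℤ *ᶻ σ *ᶻ u) +ᶻ g *ᶻ p *ᶻ (σ *ᶻ v) ≡ p *ᶻ (g *ᶻ σ *ᶻ v -ᶻ g *ᶻ σ *ᶻ u)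
    collect = solve-∀
    distribute : ∀ g σ b d e u v → g *ᶻ σ *ᶻ (b *ᶻ (d *ᶻ u)) -ᶻ g *ᶻ σ *ᶻ (b *ᶻ (e *ᶻ v)) ≡
      b *ᶻ (d *ᶻ (g *ᶻ (σ *ᶻ u)) -ᶻ e *ᶻ (g *ᶻ (σ *ᶻ v)))
    distribute = solve-∀

  -- One `step` corresponds to removing the last membership and the last entry of `a`. At r = 0 only
  -- the condition a_0 = 0 survives, which is `i = 0`.
  ∑-signedChains : ∀ r F t i → (∑[ S ∈ allSubsets r ] ∑[ a ∈ vecs r (rkM M) ] signedChains r S a F t i) ≡ E M r F t i
  ∑-signedChains zero F t i = begin
    ι (true ∧ (i ≡ᵇ 0)) *ᶻ (1ℤ *ᶻ 1ℤ) +ᶻ 0ℤ +ᶻ 0ℤ  ≡⟨ simplify (ι (i ≡ᵇ 0)) ⟩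
    ι (i ≡ᵇ 0)                                      ∎
    where
    open ≡-Reasoning
    simplify : ∀ x → x *ᶻ (1ℤ *ᶻ 1ℤ) +ᶻ 0ℤ +ᶻ 0ℤ ≡ x
    simplify = solve-∀
  ∑-signedChains (suc r) F t i = begin
    (∑[ S ∈ allSubsets (suc r) ] ∑[ a ∈ V′ ] signedChains (suc r) S a F t i)
      ≡⟨ ∑-allSubsets-∷ʳ r (λ S → ∑[ a ∈ V′ ] signedChains (suc r) S a F t i) ⟩
    (∑[ S ∈ A ] ((∑[ a ∈ V′ ] signedChains (suc r) (S ∷ʳ true) a F t i) +ᶻ (∑[ a ∈ V′ ] signedChains (suc r) (S ∷ʳ false) a F t i)))
      ≡⟨ ∑-cong A (λ S → ∑-+ V′ (λ a → signedChains (suc r) (S ∷ʳ true) a F t i) (λ a → signedChains (suc r) (S ∷ʳ false) a F t i)) ⟨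
    (∑[ S ∈ A ] ∑[ a ∈ V′ ] both S a)
      ≡⟨ ∑-cong A (λ S → ∑-vecs-∷ʳ r (rkM M) (both S)) ⟩
    (∑[ S ∈ A ] ∑[ a ∈ V ] ∑[ x ∈ X ] both S (a ++ [ x ]))
      ≡⟨ ∑-cong A (λ S → ∑-vecs-cong r (rkM M) (λ a len → ∑-cong X (λ x → signedChains-∷ʳ S a len F t i x))) ⟩
    (∑[ S ∈ A ] ∑[ a ∈ V ] step M (signedChains r S a) F t i)
      ≡⟨ ∑-cong A (λ S → step-∑ M V (λ a → signedChains r S a) F t i) ⟩
    (∑[ S ∈ A ] step M (λ G u x → ∑[ a ∈ V ] signedChains r S a G u x) F t i)
      ≡⟨ step-∑ M A (λ S G u x → ∑[ a ∈ V ] signedChains r S a G u x) F t i ⟩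
    step M (λ G u x → ∑[ S ∈ A ] ∑[ a ∈ V ] signedChains r S a G u x) F t i
      ≡⟨ step-cong M {λ G u x → ∑[ S ∈ A ] ∑[ a ∈ V ] signedChains r S a G u x} {E M r} {F} {t} {i} (λ G x _ _ _ → ∑-signedChains r G i x) (λ G x _ _ _ → ∑-signedChains r G t x) ⟩
    step M (E M r) F t i ∎
    where
    open ≡-Reasoning
    A : List (Subset r)
    A = allSubsets r
    V V′ : List (List ℕ)
    V  = vecs r (rkM M)
    V′ = vecs (suc r) (rkM M)
    both : Subset r → List ℕ → ℤ
    both S a = signedChains (suc r) (S ∷ʳ true) a F t i +ᶻ signedChains (suc r) (S ∷ʳ false) a F t i

  -- Summation over the index sequences

  isSequence : ℕ → ℕ → List ℕ → Bool
  isSequence r i a = strictlyIncr a ∧ (nth a 0 ≡ᵇ 0) ∧ (nth a r ≡ᵇ i) ∧ ((nth a (suc r) + i) ≡ᵇ rkM M)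

  isSequence-∷ʳ : ∀ r i a x y → length a ≡ r →
    isSequence r i (a ++ x ∷ y ∷ []) ≡ (admissible (a ++ [ x ]) ∧ (x <ᵇ y)) ∧ ((x ≡ᵇ i) ∧ (y + i ≡ᵇ rkM M))
  isSequence-∷ʳ r i a x y len = trans
    (sym (∧-assoc (strictlyIncr (a ++ x ∷ y ∷ [])) (nth (a ++ x ∷ y ∷ []) 0 ≡ᵇ 0) _))
    (cong₂ _∧_ (admissible-∷ʳ a x y) (cong₂ (λ u v → (u ≡ᵇ i) ∧ (v + i ≡ᵇ rkM M))
      (trans (cong (nth (a ++ x ∷ y ∷ [])) (sym (ℕP.+-identityʳ r))) (nth-++ a (x ∷ y ∷ []) 0 len))
      (trans (cong (nth (a ++ x ∷ y ∷ [])) (ℕP.+-comm 1 r)) (nth-++ a (x ∷ y ∷ []) 1 len))))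

  ∑-sequences : ∀ r i (f : List ℕ → ℤ) → ∑ (sequences (rkM M) r i) f ≡
    (∑[ a ∈ vecs r (rkM M) ] ∑[ x ∈ X ] ∑[ y ∈ X ]
      ι ((admissible (a ++ [ x ]) ∧ (x <ᵇ y)) ∧ ((x ≡ᵇ i) ∧ (y + i ≡ᵇ rkM M))) *ᶻ f (a ++ x ∷ y ∷ []))
  ∑-sequences r i f = begin
    ∑ (sequences (rkM M) r i) f
      ≡⟨ ∑-filterᵇ (isSequence r i) (vecs (suc (suc r)) (rkM M)) f ⟩
    ∑ (vecs (suc (suc r)) (rkM M)) g
      ≡⟨ ∑-vecs-∷ʳ (suc r) (rkM M) g ⟩
    (∑[ a ∈ vecs (suc r) (rkM M) ] ∑[ y ∈ X ] g (a ++ [ y ]))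
      ≡⟨ ∑-vecs-∷ʳ r (rkM M) (λ a → ∑[ y ∈ X ] g (a ++ [ y ])) ⟩
    (∑[ a ∈ vecs r (rkM M) ] ∑[ x ∈ X ] ∑[ y ∈ X ] g ((a ++ [ x ]) ++ [ y ]))
      ≡⟨ ∑-vecs-cong r (rkM M) (λ a len → ∑-cong X (λ x → ∑-cong X (λ y → trans (cong g (++-assoc a [ x ] [ y ]))
           (cong (λ b → ι b *ᶻ f (a ++ x ∷ y ∷ [])) (isSequence-∷ʳ r i a x y len))))) ⟩
    _ ∎
    where
    open ≡-Reasoning
    g : List ℕ → ℤ
    g a = ι (isSequence r i a) *ᶻ f a

  -- The last two entries are forced and lie within the range of `vecs`; the inequality between them
  -- is the hypothesis on `i`. Of the conditions only `admissible` is left.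
  ∑-sequences-long : ∀ r {i} f → i + i < rkM M → ∑ (sequences (rkM M) r i) f ≡
    (∑[ a ∈ vecs r (rkM M) ] ι (admissible (a ++ [ i ])) *ᶻ f (a ++ i ∷ (rkM M ∸ i) ∷ []))
  ∑-sequences-long r {i} f i+i<R = trans (∑-sequences r i f) (∑-cong (vecs r (rkM M)) (λ a → begin
    (∑[ x ∈ X ] ∑[ y ∈ X ] ι ((admissible (a ++ [ x ]) ∧ (x <ᵇ y)) ∧ ((x ≡ᵇ i) ∧ (y + i ≡ᵇ rkM M))) *ᶻ f (a ++ x ∷ y ∷ []))
      ≡⟨ ∑-cong X (λ x → ∑-cong X (λ y → split a x y)) ⟩
    (∑[ x ∈ X ] ∑[ y ∈ X ] ι (i ≡ᵇ x) *ᶻ (ι (t ≡ᵇ y) *ᶻ h a x y))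
      ≡⟨ ∑-cong X (λ x → ∑-*ˡ X (ι (i ≡ᵇ x)) (λ y → ι (t ≡ᵇ y) *ᶻ h a x y)) ⟩
    (∑[ x ∈ X ] ι (i ≡ᵇ x) *ᶻ (∑[ y ∈ X ] ι (t ≡ᵇ y) *ᶻ h a x y))
      ≡⟨ ∑-upTo-δ (suc (rkM M)) i (λ x → ∑[ y ∈ X ] ι (t ≡ᵇ y) *ᶻ h a x y) ⟩
    ι (i <ᵇ suc (rkM M)) *ᶻ (∑[ y ∈ X ] ι (t ≡ᵇ y) *ᶻ h a i y)
      ≡⟨ ι-true (∑[ y ∈ X ] ι (t ≡ᵇ y) *ᶻ h a i y) (<ᵇ-true⁺ (s≤s i≤R)) ⟩
    (∑[ y ∈ X ] ι (t ≡ᵇ y) *ᶻ h a i y)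
      ≡⟨ ∑-upTo-δ (suc (rkM M)) t (h a i) ⟩
    ι (t <ᵇ suc (rkM M)) *ᶻ h a i t
      ≡⟨ ι-true (h a i t) (<ᵇ-true⁺ {t} (s≤s (ℕP.m∸n≤m (rkM M) i))) ⟩
    h a i t ∎))
    where
    open ≡-Reasoning
    t : ℕ
    t = rkM M ∸ i
    h : List ℕ → ℕ → ℕ → ℤ
    h a x y = ι (admissible (a ++ [ i ])) *ᶻ f (a ++ x ∷ y ∷ [])
    i≤R : i ≤ rkM M
    i≤R = ℕP.≤-trans (ℕP.m≤m+n i i) (ℕP.<⇒≤ i+i<R)
    i<t : i < t
    i<t = ℕP.+-cancelʳ-< i i t (subst (i + i <_) (sym (ℕP.m∸n+n≡m i≤R)) i+i<R)
    same : ∀ a x y → (admissible (a ++ [ x ]) ∧ (x <ᵇ y)) ∧ ((x ≡ᵇ i) ∧ (y + i ≡ᵇ rkM M)) ≡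
      (i ≡ᵇ x) ∧ ((t ≡ᵇ y) ∧ admissible (a ++ [ i ]))
    same a x y = ⟺⇒≡ (forth , back)
      where
      forth : (admissible (a ++ [ x ]) ∧ (x <ᵇ y)) ∧ ((x ≡ᵇ i) ∧ (y + i ≡ᵇ rkM M)) ≡ true →
        (i ≡ᵇ x) ∧ ((t ≡ᵇ y) ∧ admissible (a ++ [ i ])) ≡ true
      forth e with ∧-true⁻ {admissible (a ++ [ x ]) ∧ (x <ᵇ y)} e
      ... | e₁ , e₂ with ∧-true⁻ {x ≡ᵇ i} e₂
      ... | x≡i , y+i≡R with refl ← ≡ᵇ-true⁻ {x} {i} x≡i = ∧-true⁺ (≡ᵇ-true⁺ {x} refl) (∧-true⁺
        (≡ᵇ-true⁺ (trans (cong (_∸ i) (sym (≡ᵇ-true⁻ {y + i} y+i≡R))) (ℕP.m+n∸n≡m y i)))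
        (proj₁ (∧-true⁻ {admissible (a ++ [ x ])} e₁)))
      back : (i ≡ᵇ x) ∧ ((t ≡ᵇ y) ∧ admissible (a ++ [ i ])) ≡ true →
        (admissible (a ++ [ x ]) ∧ (x <ᵇ y)) ∧ ((x ≡ᵇ i) ∧ (y + i ≡ᵇ rkM M)) ≡ true
      back e with ∧-true⁻ {i ≡ᵇ x} e
      ... | i≡x , e₁ with ∧-true⁻ {t ≡ᵇ y} e₁
      ... | t≡y , adm with refl ← ≡ᵇ-true⁻ {i} {x} i≡x with refl ← ≡ᵇ-true⁻ {t} {y} t≡y =
        ∧-true⁺ (∧-true⁺ adm (<ᵇ-true⁺ i<t)) (∧-true⁺ (≡ᵇ-true⁺ {i} refl) (≡ᵇ-true⁺ (ℕP.m∸n+n≡m i≤R)))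
    split : ∀ a x y → ι ((admissible (a ++ [ x ]) ∧ (x <ᵇ y)) ∧ ((x ≡ᵇ i) ∧ (y + i ≡ᵇ rkM M))) *ᶻ f (a ++ x ∷ y ∷ []) ≡
      ι (i ≡ᵇ x) *ᶻ (ι (t ≡ᵇ y) *ᶻ h a x y)
    split a x y = trans (cong (λ b → ι b *ᶻ f (a ++ x ∷ y ∷ [])) (same a x y))
      (trans (cong (_*ᶻ f (a ++ x ∷ y ∷ [])) (trans (ι-∧ (i ≡ᵇ x) _) (cong (ι (i ≡ᵇ x) *ᶻ_) (ι-∧ (t ≡ᵇ y) (admissible (a ++ [ i ]))))))
        (regroup (ι (i ≡ᵇ x)) (ι (t ≡ᵇ y)) (ι (admissible (a ++ [ i ]))) (f (a ++ x ∷ y ∷ []))))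
      where
      regroup : ∀ p q g u → p *ᶻ (q *ᶻ g) *ᶻ u ≡ p *ᶻ (q *ᶻ (g *ᶻ u))
      regroup = solve-∀

  -- The requirement a_r < a_{r+1} reads i < rk M - i, so there is no sequence to sum over.
  ∑-sequences-short : ∀ r {i} f → rkM M ≤ i + i → ∑ (sequences (rkM M) r i) f ≡ 0ℤ
  ∑-sequences-short r {i} f R≤i+i = trans (∑-sequences r i f) (∑-zero (vecs r (rkM M)) (λ a →
    ∑-zero X (λ x → ∑-zero X (λ y → ι-false (f (a ++ x ∷ y ∷ [])) (impossible a x y)))))
    where
    impossible : ∀ a x y → ¬ (admissible (a ++ [ x ]) ∧ (x <ᵇ y)) ∧ ((x ≡ᵇ i) ∧ (y + i ≡ᵇ rkM M)) ≡ true
    impossible a x y e with ∧-true⁻ {admissible (a ++ [ x ]) ∧ (x <ᵇ y)} e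
    ... | e₁ , e₂ with ∧-true⁻ {x ≡ᵇ i} e₂
    ... | x≡i , y+i≡R with refl ← ≡ᵇ-true⁻ {x} {i} x≡i = ℕP.<⇒≱
      (subst (i + i <_) (≡ᵇ-true⁻ {y + i} y+i≡R) (ℕP.+-monoˡ-< i (<ᵇ-true⁻ (proj₂ (∧-true⁻ {admissible (a ++ [ x ])} e₁))))) R≤i+i

  -- Evaluation of the right-hand side

  rhs-long : ∀ {i} → 0 < i → i + i < rkM M → rhs M i ≡ (∑[ r ∈ upTo (suc i) ] E M r (bottom M) (rkM M ∸ i) i)
  rhs-long {i@(suc _)} 0<i i+i<R = begin
    rhs M i
      ≡⟨ ∑-map suc (upTo i) (λ r → ∑[ S ∈ allSubsets r ] ∑ (sequences (rkM M) r i) (summand r S)) ⟩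
    (∑[ r ∈ upTo i ] ∑[ S ∈ allSubsets (suc r) ] ∑ (sequences (rkM M) (suc r) i) (summand (suc r) S))
      ≡⟨ ∑-cong (upTo i) (λ r → trans (∑-cong (allSubsets (suc r)) (λ S → trans
           (∑-sequences-long (suc r) (summand (suc r) S) i+i<R)
           (∑-cong (vecs (suc r) (rkM M)) (λ a → cong (λ w → ι (admissible (a ++ [ i ])) *ᶻ (-1ℤ ^ ∣ S ∣ *ᶻ w))
             (whitney-chains (whitneyArgs (suc r) S (a ++ i ∷ (rkM M ∸ i) ∷ [])))))))
           (∑-signedChains (suc r) (bottom M) (rkM M ∸ i) i)) ⟩
    (∑[ r ∈ upTo i ] E M (suc r) (bottom M) (rkM M ∸ i) i)
      -- The term r = 0 would be `ι (i ≡ᵇ 0)`, which is zero for positive `i`; this is why the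
      -- formula can start at r = 1.
      ≡⟨ ℤP.+-identityˡ _ ⟨
    0ℤ +ᶻ (∑[ r ∈ upTo i ] E M (suc r) (bottom M) (rkM M ∸ i) i)
      ≡⟨ ∑-upTo-suc i (λ r → E M r (bottom M) (rkM M ∸ i) i) ⟨
    (∑[ r ∈ upTo (suc i) ] E M r (bottom M) (rkM M ∸ i) i) ∎
    where
    open ≡-Reasoning
    summand : ∀ r → Subset r → List ℕ → ℤ
    summand r S a = -1ℤ ^ ∣ S ∣ *ᶻ ℤ.+ whitney M (whitneyArgs r S a)

  rhs-short : ∀ {i} → rkM M ≤ i + i → rhs M i ≡ 0ℤ
  rhs-short {i} R≤i+i = ∑-zero (map suc (upTo i)) (λ r → ∑-zero (allSubsets r) (λ S →
    ∑-sequences-short r (λ a → -1ℤ ^ ∣ S ∣ *ᶻ ℤ.+ whitney M (whitneyArgs r S a)) R≤i+i))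

  crk-bottom : crk M (bottom M) ≡ rkM M
  crk-bottom = cong (rkM M ∸_) (rk-bottom M)

theorem3p3 : ∀ {n} (M : Matroid n) (P : Subset n → Subset n → ℕ → ℤ) →
    IsKL M P → ∀ (i : ℕ) → 0 < i → P (bottom M) ⊤ i ≡ rhs M i
theorem3p3 M P kl i 0<i with suc (i + i) ≤? rkM M
... | yes i+i<R = sym (trans (rhs-long M 0<i i+i<R) (∑E≡C M P kl i (bottom-flat M) ℕP.≤-refl
      (ℕP.+-cancelʳ-< i i (rkM M ∸ i) (subst (i + i <_) (sym (ℕP.m∸n+n≡m i≤R)) i+i<R))
      (trans (crk-bottom M) (sym (ℕP.m+[n∸m]≡n i≤R)))))
  where
  i≤R : i ≤ rkM M
  i≤R = ℕP.≤-trans (ℕP.m≤m+n i i) (ℕP.<⇒≤ i+i<R)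
... | no i+i≮R = trans (vanish i 0<i (ℕP.≮⇒≥ i+i≮R) (rkM M) refl) (sym (rhs-short M {i} (ℕP.≮⇒≥ i+i≮R)))
  where
  -- The degree bound speaks only of positive rank; in rank zero the polynomial is `1`, whose
  -- coefficients in positive degrees are zero. The copy `R` of the rank exists to be matched on.
  vanish : ∀ i → 0 < i → rkM M ≤ i + i → ∀ R → rkM M ≡ R → P (bottom M) ⊤ i ≡ 0ℤ
  vanish (suc i) _ _ zero    R≡ = proj₁ (kl (bottom M) ⊤ (bottom-flat M) (⊤-flat M) (⊆ᵇ-⊤ (bottom M))) (trans (crk-bottom M) R≡) (suc i)
  vanish i       _ h (suc R) R≡ = C-vanish M P kl (bottom-flat M) (subst (0 <_) (sym (trans (crk-bottom M) R≡)) (s≤s z≤n))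
    (subst (_≤ i + i) (sym (crk-bottom M)) h)
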